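{- Let $\mathcal{P}$ be a non-empty finite set of odd primes and let $k\in\mathbb{N}$ be a product of prime powers with primes from $\mathcal{P}$. Let $m$ be a power of $2$. Suppose that for each $p\in\mathcal{P}$ and each $n\geq 1$ the group $(\mathbb{Z}_p)^n$ satisfies Property D. Then there exists $c(k)$ with $1<c(k)<k$, depending only on $k$, such that for every $n\geq 1$ $$ s((\mathbb{Z}_{mk})^n)\leq 2^n(m-1)k+c(k)^n(k-1)+1. $$
   Context: A sequence over a finite abelian group $A$ is a finite unordered list of elements of $A$ with repetitions allowed; its length counts multiplicity, a subsequence is a sub-multiset, a zero-sum sequence is one whose terms sum to $0$, and $T^{j}$ denotes the sequence in which every term of $T$ is repeated $j$ times. The Erdős–Ginzburg–Ziv constant $s(A)$ is the smallest integer $\ell$ such that every sequence over $A$ of length at least $\ell$ has a zero-sum subsequence of length $\exp(A)$ (the exponent of $A$). The group $(\mathbb{Z}_q)^n$ satisfies Property D if every sequence $S$ over it of length $s((\mathbb{Z}_q)^n)-1$ with no zero-sum subsequence of length $q$ has the form $S=T^{q-1}$ for some sequence $T$. -}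

module Defs where

open import Data.Nat using (ℕ; zero; suc; _+_; _*_; _∸_; _^_; _≤_; _<_)
open import Data.Nat.Divisibility using (_∣_)
open import Data.Nat.Primality using (Prime)
open import Data.Fin using (Fin; toℕ)
open import Data.Vec using (Vec; lookup)
open import Data.List using (List; length; map; concatMap; replicate)
open import Data.Nat.ListAction using (sum)
open import Data.List.Membership.Propositional using (_∈_)
open import Data.List.Relation.Binary.Sublist.Propositional using (_⊆_)
open import Data.List.Relation.Binary.Permutation.Propositional using (_↭_)
open import Data.Product using (Σ; ∃; _×_)
open import Relation.Nullary using (¬_)
open import Relation.Binary.PropositionalEquality using (_≡_)
open import Data.Integer using (+_)
import Data.Rational as Q

-- The group (ℤ_q)^n: elements are vectors of residues Fin q.
Elem : ℕ → ℕ → Set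
Elem q n = Vec (Fin q) n

-- A sequence over (ℤ_q)^n: a finite list (order is irrelevant for all notions below).
Seq : ℕ → ℕ → Set
Seq q n = List (Elem q n)

ZeroSum : ∀ {q n} → Seq q n → Set
ZeroSum {q} {n} S = (i : Fin n) → q ∣ sum (map (λ v → toℕ (lookup v i)) S)

HasZeroSumSubseqOfLength : ∀ {q n} → ℕ → Seq q n → Set
HasZeroSumSubseqOfLength {q} {n} ℓ S = Σ (Seq q n) λ T → T ⊆ S × length T ≡ ℓ × ZeroSum T

-- Exponent of (ℤ_q)^n for n ≥ 1 is q.
-- ℓ has the EGZ property: every sequence of length ≥ ℓ has a zero-sum
-- subsequence of length exp = q.
EGZProperty : ℕ → ℕ → ℕ → Set
EGZProperty q n ℓ = (S : Seq q n) → ℓ ≤ length S → HasZeroSumSubseqOfLength q S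

IsEGZConstant : ℕ → ℕ → ℕ → Set
IsEGZConstant q n s = EGZProperty q n s × ((ℓ : ℕ) → EGZProperty q n ℓ → s ≤ ℓ)

rep : ∀ {A : Set} → List A → ℕ → List A
rep T j = concatMap (λ x → replicate j x) T

PropertyD : ℕ → ℕ → Set
PropertyD q n = (s : ℕ) → IsEGZConstant q n s →
  (S : Seq q n) → length S ≡ s ∸ 1 → ¬ HasZeroSumSubseqOfLength q S →
  Σ (Seq q n) λ T → S ↭ rep T (q ∸ 1)

IsPowerOf2 : ℕ → Set
IsPowerOf2 m = ∃ λ a → m ≡ 2 ^ a

ℕtoℚ : ℕ → Q.ℚ
ℕtoℚ n = (+ n) Q./ 1

_^ℚ_ : Q.ℚ → ℕ → Q.ℚ
c ^ℚ zero = Q.1ℚ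
c ^ℚ suc n = c Q.* (c ^ℚ n)

{-# OPTIONS --safe #-}

-- For an odd prime p, a sequence T^(p−1) without zero-sum subsequences of length p is
-- determined by a sequence T in which a + b + (p − 2) c = 0 only for three equal terms;
-- that is, T has no non-trivial three-term progression.  Ellenberg–Gijswijt, in the
-- slice rank form: ∏ over the coordinates of φ(x + y + z), φ(s) = (s + 1) ⋯ (s + p − 1),
-- is diagonal modulo p on triples (a, b, (p − 2) c), and each of its monomials has degree
-- at most n (p − 1) / 3 in one of x, y, z, so |T| ≤ 3 M for the number M of such low degree
-- monomials.  A Chernoff bound gives M ≤ γⁿ with a rational γ < p, and the same inequality
-- for the powers of T in higher dimension removes the factor 3.  By Property D this bounds
-- s(ℤ_pⁿ).  Writing e = s − 1, the inequality e(ab) ≤ e(a) b + e(b) extends the bound to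
-- products of primes, with c(k) the largest of the γ, and finally to 2^a k.
module Submission where

open import Defs
open import Algebra.Bundles using (CommutativeMonoid)
open import Data.Bool using (if_then_else_)
open import Data.Fin using (Fin; zero; suc; toℕ; finToFun; funToFin; combine; remQuot)
open import Data.Fin.Properties using (all?; ¬∀⟶∃¬; toℕ-fromℕ<; funToFin-finToFin; remQuot-combine) renaming (_≟_ to _≟ᶠ_)
import Data.Integer as ℤ
import Data.Integer.Properties as ℤ
open import Data.List as List using (List; []; _∷_; length; map; _++_; concatMap; take; filter; replicate; reverse; cartesianProductWith; upTo; downFrom; applyUpTo; allFin)
open import Data.List.Properties using (map-∘; map-++; length-map; length-++; length-take; length-tabulate; length-replicate; length-upTo; map-applyUpTo; reverse-applyUpTo; concatMap-++; ++-assoc)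
open import Data.List.Membership.Propositional using (_∈_)
open import Data.List.Membership.Propositional.Properties using (∈-cartesianProductWith⁺; ∈-upTo⁺; ∈-filter⁺; ∈-map⁺; ∈-allFin)
open import Data.List.Relation.Binary.Permutation.Propositional using (_↭_; refl; prep; swap; ↭-refl; ↭-sym; ↭-trans; ↭-reflexive) renaming (trans to ↭-transitive)
open import Data.List.Relation.Binary.Permutation.Propositional.Properties using (All-resp-↭; ↭-length; ↭-reverse; map⁺; ++⁺ˡ; ++⁺ʳ; shift; shifts)
open import Data.List.Relation.Binary.Sublist.Propositional using (_⊆_; []; _∷_; _∷ʳ_; ⊆-trans; ⊆-refl; minimum) renaming (lookup to ⊆-lookup)
open import Data.List.Relation.Binary.Sublist.Propositional.Properties as Sublist using (All-resp-⊆; filter-⊆; take-⊆)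
open import Data.List.Relation.Unary.All as All using (All; []; _∷_)
import Data.List.Relation.Unary.All.Properties as All
open import Data.List.Relation.Unary.AllPairs using ([]; _∷_)
open import Data.List.Relation.Unary.Any using (here; there)
open import Data.List.Relation.Unary.Unique.Propositional using (Unique)
open import Data.List.Relation.Unary.Unique.Propositional.Properties using (allFin⁺)
open import Data.Nat
open import Data.Nat.Divisibility
open import Data.Nat.DivMod using (_mod_; m%n<n; m≡m%n+[m/n]*n)
open import Data.Nat.ListAction using (sum; product)
open import Data.Nat.ListAction.Properties using (sum-++; sum-↭; ∈⇒∣product)
open import Data.Nat.Primality using (Prime; euclidsLemma; prime⇒nonTrivial)
open import Data.Nat.Primality.Factorisation using (factorise)
open import Data.Nat.Properties
open import Data.Nat.Tactic.RingSolver using (solve-∀)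
open import Data.Product using (Σ; ∃; ∃₂; _×_; _,_; proj₁; proj₂)
import Data.Rational as Q
import Data.Rational.Properties as Q
import Data.Rational.Unnormalised as ℚᵘ
import Data.Rational.Unnormalised.Properties as ℚᵘ
open import Data.Sum using (_⊎_; inj₁; inj₂; [_,_]′)
open import Data.Vec as Vec using (Vec; []; _∷_; lookup; toList)
open import Data.Vec.Properties using (lookup∘tabulate; lookup-map; ≡-dec; length-toList)
open import Data.Vec.Relation.Unary.All as VecAll using ([]; _∷_) renaming (All to VecAll)
open import Function using (_∘_; flip; id)
open import Relation.Binary.PropositionalEquality using (_≡_; _≢_; refl; sym; trans; cong; cong₂; subst; setoid; module ≡-Reasoning)
open import Relation.Nullary using (¬_; Dec; yes; no; does; contradiction; ¬?; _×-dec_)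
open import Algebra.Properties.CommutativeSemigroup (CommutativeMonoid.commutativeSemigroup Q.*-1-commutativeMonoid) using (interchange; xy∙z≈xz∙y)

-- Finite sums

-- The bound must hold for every n ≥ 1 with no constant in front of c(k)ⁿ. A factor 3 cannot be
-- absorbed into the rate: for k = p and n = 1 this would ask for 3 γ < p, which fails for p = 3
-- because γ > 1. The powers of T inherit freeness from progressions coordinate by coordinate, and
-- the asymptotics in the exponent then speak about T itself. A rate γ < p exists because an
-- exponent in 0, ..., p - 1 has mean (p - 1) / 2, while low degree asks for mean at most (p - 1) /
-- 3. Rank appears only through its main consequence: more unknowns than linear forms leave a
-- non-zero solution. Contracting one index of the tensor with such a solution reduces slice rank to
-- the rank of a matrix. Residues are natural numbers compared by divisibility and inequalities are
-- cleared of denominators; γ stays a pair A, B until the theorem itself needs a rational.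

∑ : ∀ {A : Set} → (A → ℕ) → List A → ℕ
∑ f xs = sum (map f xs)

module _ {A : Set} where

  ∑-cong : ∀ {f g : A → ℕ} → (∀ x → f x ≡ g x) → ∀ xs → ∑ f xs ≡ ∑ g xs
  ∑-cong e []       = refl
  ∑-cong e (x ∷ xs) = cong₂ _+_ (e x) (∑-cong e xs)

  ∑-++ : ∀ (f : A → ℕ) xs ys → ∑ f (xs ++ ys) ≡ ∑ f xs + ∑ f ys
  ∑-++ f xs ys = trans (cong sum (map-++ f xs ys)) (sum-++ (map f xs) (map f ys))

  ∑-map : ∀ {B : Set} (f : B → ℕ) (g : A → B) xs → ∑ f (map g xs) ≡ ∑ (f ∘ g) xs
  ∑-map f g xs = cong sum (sym (map-∘ xs))

  ∑-↭ : ∀ (f : A → ℕ) {xs ys} → xs ↭ ys → ∑ f xs ≡ ∑ f ys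
  ∑-↭ f xs↭ys = sum-↭ (map⁺ f xs↭ys)

  ∑-+ : ∀ (f g : A → ℕ) xs → ∑ (λ x → f x + g x) xs ≡ ∑ f xs + ∑ g xs
  ∑-+ f g []       = refl
  ∑-+ f g (x ∷ xs) = trans (cong (f x + g x +_) (∑-+ f g xs)) (lemma (f x) (g x) (∑ f xs) (∑ g xs))
    where
    lemma : ∀ a b c d → a + b + (c + d) ≡ a + c + (b + d)
    lemma = solve-∀

  ∑-*ˡ : ∀ c (f : A → ℕ) xs → ∑ (λ x → c * f x) xs ≡ c * ∑ f xs
  ∑-*ˡ c f []       = sym (*-zeroʳ c)
  ∑-*ˡ c f (x ∷ xs) = trans (cong (c * f x +_) (∑-*ˡ c f xs)) (sym (*-distribˡ-+ c (f x) (∑ f xs)))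

  ∑-0 : ∀ (xs : List A) → ∑ (λ _ → 0) xs ≡ 0
  ∑-0 []       = refl
  ∑-0 (x ∷ xs) = ∑-0 xs

  ∑-mono : ∀ {f g : A → ℕ} {xs} → All (λ x → f x ≤ g x) xs → ∑ f xs ≤ ∑ g xs
  ∑-mono []          = z≤n
  ∑-mono (f≤g ∷ all) = +-mono-≤ f≤g (∑-mono all)

  ∑-const : ∀ c (xs : List A) → ∑ (λ _ → c) xs ≡ length xs * c
  ∑-const c []       = refl
  ∑-const c (x ∷ xs) = cong (c +_) (∑-const c xs)

  ∣-∑ : ∀ {p} {f : A → ℕ} {xs} → All (λ x → p ∣ f x) xs → p ∣ ∑ f xs
  ∣-∑ []         = _ ∣0
  ∣-∑ (d ∷ all) = ∣m∣n⇒∣m+n d (∣-∑ all)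

∑-swap : ∀ {A B : Set} (f : A → B → ℕ) xs ys → ∑ (λ x → ∑ (f x) ys) xs ≡ ∑ (λ y → ∑ (λ x → f x y) xs) ys
∑-swap f []       ys = sym (∑-0 ys)
∑-swap f (x ∷ xs) ys = trans (cong (∑ (f x) ys +_) (∑-swap f xs ys)) (sym (∑-+ (f x) (λ y → ∑ (λ x → f x y) xs) ys))

∑-cartesianProductWith : ∀ {A B C : Set} (g : A → B → C) (f : C → ℕ) xs ys →
  ∑ f (cartesianProductWith g xs ys) ≡ ∑ (λ x → ∑ (λ y → f (g x y)) ys) xs
∑-cartesianProductWith g f []       ys = refl
∑-cartesianProductWith g f (x ∷ xs) ys =
  trans (∑-++ f (map (g x) ys) (cartesianProductWith g xs ys))
        (cong₂ _+_ (∑-map f (g x) ys) (∑-cartesianProductWith g f xs ys))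

∑-*-∑ : ∀ {A B : Set} (f : A → ℕ) (g : B → ℕ) xs ys →
  ∑ (λ x → ∑ (λ y → f x * g y) ys) xs ≡ ∑ f xs * ∑ g ys
∑-*-∑ f g xs ys = begin
  ∑ (λ x → ∑ (λ y → f x * g y) ys) xs ≡⟨ ∑-cong (λ x → trans (∑-*ˡ (f x) g ys) (*-comm (f x) (∑ g ys))) xs ⟩
  ∑ (λ x → ∑ g ys * f x) xs           ≡⟨ ∑-*ˡ (∑ g ys) f xs ⟩
  ∑ g ys * ∑ f xs                     ≡⟨ *-comm (∑ g ys) (∑ f xs) ⟩
  ∑ f xs * ∑ g ys                     ∎
  where open ≡-Reasoning

-- Linear algebra modulo a prime

-- A vector over the field of p elements, listed by its support with representatives of its
-- coordinates. The length of the list is then the size of the support, which is the quantity that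
-- the rank arguments count.
Weighted : Set → Set
Weighted A = List (A × ℕ)

support : ∀ {A : Set} → Weighted A → List A
support = map proj₁

infix 8 _·_
_·_ : ∀ {A : Set} → (A → ℕ) → Weighted A → ℕ
f · ws = ∑ (λ aw → proj₂ aw * f (proj₁ aw)) ws

module _ {A : Set} where

  ·-cong : ∀ {f g : A → ℕ} → (∀ a → f a ≡ g a) → ∀ ws → f · ws ≡ g · ws
  ·-cong e = ∑-cong (λ aw → cong (proj₂ aw *_) (e (proj₁ aw)))

  ·-+ : ∀ (f g : A → ℕ) ws → (λ a → f a + g a) · ws ≡ f · ws + g · ws
  ·-+ f g ws = trans (∑-cong (λ aw → *-distribˡ-+ (proj₂ aw) (f (proj₁ aw)) (g (proj₁ aw))) ws) (∑-+ _ _ ws)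

  ·-* : ∀ c (f : A → ℕ) ws → (λ a → c * f a) · ws ≡ c * f · ws
  ·-* c f ws = trans (∑-cong (λ aw → lemma (proj₂ aw) c (f (proj₁ aw))) ws) (∑-*ˡ c _ ws)
    where
    lemma : ∀ w c x → w * (c * x) ≡ c * (w * x)
    lemma = solve-∀

  ·-∑ : ∀ {B : Set} (f : B → A → ℕ) bs ws → (λ a → ∑ (λ b → f b a) bs) · ws ≡ ∑ (λ b → f b · ws) bs
  ·-∑ f bs ws = trans (∑-cong (λ aw → sym (∑-*ˡ (proj₂ aw) _ bs)) ws) (∑-swap _ ws bs)

  scale : ℕ → Weighted A → Weighted A
  scale c = map (λ aw → proj₁ aw , c * proj₂ aw)

  support-scale : ∀ c ws → support (scale c ws) ≡ support ws
  support-scale c ws = sym (map-∘ ws)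

  ·-scale : ∀ (f : A → ℕ) c ws → f · scale c ws ≡ c * f · ws
  ·-scale f c ws = begin
    f · scale c ws                                          ≡⟨ ∑-map _ _ ws ⟩
    ∑ (λ aw → c * proj₂ aw * f (proj₁ aw)) ws               ≡⟨ ∑-cong (λ aw → *-assoc c (proj₂ aw) (f (proj₁ aw))) ws ⟩
    ∑ (λ aw → c * (proj₂ aw * f (proj₁ aw))) ws             ≡⟨ ∑-*ˡ c _ ws ⟩
    c * f · ws                                              ∎
    where open ≡-Reasoning

  ·-∣ : ∀ {p} {f : A → ℕ} → (∀ a → p ∣ f a) → ∀ ws → p ∣ f · ws
  ·-∣ p∣f ws = ∣-∑ {xs = ws} (All.tabulate (λ {aw} _ → ∣n⇒∣m*n (proj₂ aw) (p∣f (proj₁ aw))))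

-- The pivot search of the elimination: either no form involves the unknown, or one that does is
-- moved to the front.
find¬ : ∀ {A : Set} {P : A → Set} → (∀ a → Dec (P a)) → ∀ xs →
  All P xs ⊎ ∃₂ λ x ys → ¬ P x × xs ↭ x ∷ ys
find¬ P? [] = inj₁ []
find¬ P? (x ∷ xs) with P? x
... | no ¬px = inj₂ (x , xs , ¬px , ↭-refl)
... | yes px with find¬ P? xs
...   | inj₁ all                  = inj₁ (px ∷ all)
...   | inj₂ (y , ys , ¬py , eq) = inj₂ (y , x ∷ ys , ¬py , ↭-trans (prep x eq) (swap x y ↭-refl))

module _ {p : ℕ} (prime : Prime p) where

  ∤-* : ∀ {m n} → p ∤ m → p ∤ n → p ∤ m * n
  ∤-* p∤m p∤n p∣mn = [ p∤m , p∤n ]′ (euclidsLemma _ _ prime p∣mn)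

  ∤1 : p ∤ 1
  ∤1 p∣1 = >⇒∤ (nonTrivial⇒n>1 p {{prime⇒nonTrivial prime}}) p∣1

  -- Fraction-free Gaussian elimination modulo p; the coefficient p ∸ 1 plays the
  -- role of −1.  Every non-pivot unknown gets a non-zero weight.
  kernel : ∀ {A : Set} (xs : List A) (fs : List (A → ℕ)) → ∃ λ ws →
    support ws ⊆ xs × All (λ aw → p ∤ proj₂ aw) ws ×
    All (λ f → p ∣ f · ws) fs × length xs ≤ length ws + length fs
  kernel [] fs = [] , [] , [] , All.tabulate (λ _ → p ∣0) , z≤n
  kernel {A} (x ∷ xs) fs with find¬ (λ f → p ∣? f x) fs
  ... | inj₁ p∣fx with kernel xs fs
  ...   | ws , ws⊆ , ws∤ , kills , len =
          (x , 1) ∷ ws , refl ∷ ws⊆ , ∤1 ∷ ws∤ ,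
          All.zipWith (λ (d , e) → ∣m∣n⇒∣m+n (∣n⇒∣m*n 1 d) e) (p∣fx , kills) ,
          s≤s len
  kernel {A} (x ∷ xs) fs | inj₂ (f , gs , p∤fx , fs↭) = extend (kernel xs (map eliminate gs))
    where
    eliminate : (A → ℕ) → A → ℕ
    eliminate g a = f x * g a + (p ∸ 1) * g x * f a
    extend : ∃ _ → ∃ _
    extend (ws , ws⊆ , ws∤ , kills , len) = finish (p ∣? h₀)
      where
      -- The weight of the pivot: it solves the pivot equation for `x` without division, once all
      -- other weights are multiplied by `f x`.
      h₀ = (p ∸ 1) * f · ws
      ws′ = scale (f x) ws
      ws′⊆ : support ws′ ⊆ xs
      ws′⊆ = subst (_⊆ xs) (sym (support-scale (f x) ws)) ws⊆
      ws′∤ : All (λ aw → p ∤ proj₂ aw) ws′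
      ws′∤ = All.map⁺ (All.map (∤-* p∤fx) ws∤)
      p∣-f : p ∣ h₀ * f x + f · ws′
      p∣-f = divides (f x * f · ws) (begin
        h₀ * f x + f · ws′                          ≡⟨ cong (h₀ * f x +_) (·-scale f (f x) ws) ⟩
        (p ∸ 1) * f · ws * f x + f x * f · ws       ≡⟨ lemma (p ∸ 1) (f · ws) (f x) ⟩
        f x * f · ws * suc (p ∸ 1)                  ≡⟨ cong (f x * f · ws *_) (suc-pred p {{nonTrivial⇒nonZero p {{prime⇒nonTrivial prime}}}}) ⟩
        f x * f · ws * p                            ∎)
        where
        open ≡-Reasoning
        lemma : ∀ q s c → q * s * c + c * s ≡ c * s * suc q
        lemma = solve-∀
      p∣-g : ∀ g → p ∣ eliminate g · ws → p ∣ h₀ * g x + g · ws′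
      p∣-g g = subst (p ∣_) (begin
        eliminate g · ws                                       ≡⟨ ·-+ _ _ ws ⟩
        (λ a → f x * g a) · ws + (λ a → (p ∸ 1) * g x * f a) · ws ≡⟨ cong₂ _+_ (·-* (f x) g ws) (·-* ((p ∸ 1) * g x) f ws) ⟩
        f x * g · ws + (p ∸ 1) * g x * f · ws                  ≡⟨ lemma (f x) (g · ws) (p ∸ 1) (g x) (f · ws) ⟩
        h₀ * g x + f x * g · ws                                ≡⟨ cong (h₀ * g x +_) (sym (·-scale g (f x) ws)) ⟩
        h₀ * g x + g · ws′                                     ∎)
        where
        open ≡-Reasoning
        lemma : ∀ c s q d t → c * s + q * d * t ≡ q * t * d + c * s
        lemma = solve-∀
      kills′ : All (λ g → p ∣ h₀ * g x + g · ws′) fs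
      kills′ = All-resp-↭ (↭-sym fs↭) (p∣-f ∷ All.map (λ {g} → p∣-g g) (All.map⁻ kills))
      len′ : length (x ∷ xs) ≤ length ws′ + length fs
      len′ = begin
        suc (length xs)                              ≤⟨ s≤s len ⟩
        suc (length ws + length (map eliminate gs))  ≡⟨ cong₂ (λ a b → suc (a + b)) (sym (length-map _ ws)) (length-map _ gs) ⟩
        suc (length ws′ + length gs)                 ≡⟨ +-suc (length ws′) (length gs) ⟨
        length ws′ + suc (length gs)                 ≡⟨ cong (length ws′ +_) (↭-length fs↭) ⟨
        length ws′ + length fs                       ∎
        where open ≤-Reasoning
      finish : Dec (p ∣ h₀) → ∃ _
      finish (no  p∤h₀) = (x , h₀) ∷ ws′ , refl ∷ ws′⊆ , p∤h₀ ∷ ws′∤ , kills′ , m≤n⇒m≤1+n len′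
      -- A pivot weight that is zero modulo p is dropped, so that all listed weights stay non-zero.
      -- The length bound already allows one lost unknown per form.
      finish (yes p∣h₀) = ws′ , x ∷ʳ ws′⊆ , ws′∤ ,
        All.map (λ {g} d → ∣m+n∣m⇒∣n d (∣m⇒∣m*n (g x) p∣h₀)) kills′ , len′

  -- Only the term at `a` survives modulo p. Uniqueness of the support ensures that it survives
  -- once; several weights at `a` might cancel.
  ·-isolate : ∀ {A : Set} {g : A → ℕ} {a} ws → Unique (support ws) → All (λ aw → p ∤ proj₂ aw) ws →
    a ∈ support ws → p ∤ g a → (∀ b → b ≢ a → p ∣ g b) → p ∤ g · ws
  ·-isolate {g = g} ((a , w) ∷ ws) (a∉ ∷ _) (p∤w ∷ _) (here refl) p∤ga others p∣ =
    ∤-* p∤w p∤ga (∣m+n∣m⇒∣n (subst (p ∣_) (+-comm (w * g a) (g · ws)) p∣)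
      (∣-∑ (All.map (λ {bw} a≢b → ∣n⇒∣m*n (proj₂ bw) (others (proj₁ bw) (a≢b ∘ sym))) (All.map⁻ a∉))))
  ·-isolate {g = g} ((b , w) ∷ ws) (b∉ ∷ unique) (_ ∷ ws∤) (there a∈) p∤ga others p∣ =
    ·-isolate ws unique ws∤ a∈ p∤ga others
      (∣m+n∣m⇒∣n p∣ (∣n⇒∣m*n w (others b (All.lookup b∉ a∈))))

module _ {I J : Set} where

  -- A factorisation of the matrix `D` of rank at most `length fs`. The left factors are fixed in
  -- advance and the right factors are existential, so a sum of many products over the same `fs`
  -- does not raise the rank.
  Span : List (I → ℕ) → (I → J → ℕ) → Set
  Span []       D = ∀ i j → D i j ≡ 0
  Span (f ∷ fs) D = ∃₂ λ (G : J → ℕ) D′ → (∀ i j → D i j ≡ f i * G j + D′ i j) × Span fs D′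

  span-0 : ∀ fs → Span fs (λ _ _ → 0)
  span-0 []       = λ _ _ → refl
  span-0 (f ∷ fs) = (λ _ → 0) , _ , (λ i _ → sym (trans (+-identityʳ _) (*-zeroʳ (f i)))) , span-0 fs

  span-+ : ∀ fs {D E} → Span fs D → Span fs E → Span fs (λ i j → D i j + E i j)
  span-+ []       D≡0 E≡0 = λ i j → cong₂ _+_ (D≡0 i j) (E≡0 i j)
  span-+ (f ∷ fs) (G , D′ , D≡ , s) (H , E′ , E≡ , t) =
    (λ j → G j + H j) , _ ,
    (λ i j → trans (cong₂ _+_ (D≡ i j) (E≡ i j)) (lemma (f i) (G j) (D′ i j) (H j) (E′ i j))) ,
    span-+ fs s t
    where
    lemma : ∀ f g d h e → f * g + d + (f * h + e) ≡ f * (g + h) + (d + e)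
    lemma = solve-∀

  span-∈ : ∀ {f fs} → f ∈ fs → (g : J → ℕ) → Span fs (λ i j → f i * g j)
  span-∈ {fs = _ ∷ fs} (here refl) g = g , _ , (λ _ _ → sym (+-identityʳ _)) , span-0 fs
  span-∈ {f} {f′ ∷ fs} (there f∈) g =
    (λ _ → 0) , _ , (λ i j → cong (_+ f i * g j) (sym (*-zeroʳ (f′ i)))) , span-∈ f∈ g

  span-kill : ∀ {p} fs {D} → Span fs D → ∀ ws → All (λ f → p ∣ f · ws) fs → ∀ j → p ∣ (λ i → D i j) · ws
  span-kill []       D≡0 ws [] j = ·-∣ (λ i → subst (_ ∣_) (sym (D≡0 i j)) (_ ∣0)) ws
  span-kill {p} (f ∷ fs) {D} (G , D′ , D≡ , s) ws (d ∷ ds) j =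
    subst (p ∣_) (sym (begin
      (λ i → D i j) · ws                          ≡⟨ ·-cong (λ i → trans (D≡ i j) (cong (_+ D′ i j) (*-comm (f i) (G j)))) ws ⟩
      (λ i → G j * f i + D′ i j) · ws             ≡⟨ ·-+ _ _ ws ⟩
      (λ i → G j * f i) · ws + (λ i → D′ i j) · ws ≡⟨ cong (_+ (λ i → D′ i j) · ws) (·-* (G j) f ws) ⟩
      G j * f · ws + (λ i → D′ i j) · ws          ∎))
    (∣m∣n⇒∣m+n (∣n⇒∣m*n (G j) d) (span-kill fs s ws ds j))
    where open ≡-Reasoning

  -- Here the weights sit on the second index, so the forms to be annihilated are the right factors
  -- of the factorisation. Only their number is known, and it is all that the count uses.
  span-dual : ∀ fs {D} → Span fs D → ∃ λ Gs → length Gs ≡ length fs ×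
    (∀ {p} ws → All (λ G → p ∣ G · ws) Gs → ∀ i → p ∣ D i · ws)
  span-dual []       D≡0 = [] , refl , λ ws _ i → ·-∣ (λ j → subst (_ ∣_) (sym (D≡0 i j)) (_ ∣0)) ws
  span-dual (f ∷ fs) {D} (G , D′ , D≡ , s) with span-dual fs s
  ... | Gs , len , kill = G ∷ Gs , cong suc len , λ { {p} ws (d ∷ ds) i →
    subst (p ∣_) (sym (begin
      D i · ws                          ≡⟨ ·-cong (D≡ i) ws ⟩
      (λ j → f i * G j + D′ i j) · ws   ≡⟨ ·-+ _ _ ws ⟩
      (λ j → f i * G j) · ws + D′ i · ws ≡⟨ cong (_+ D′ i · ws) (·-* (f i) G ws) ⟩
      f i * G · ws + D′ i · ws          ∎))
    (∣m∣n⇒∣m+n (∣n⇒∣m*n (f i) d) (kill ws ds i)) }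
    where open ≡-Reasoning

-- The polynomial tensor

vecs : ∀ {A : Set} → List A → ∀ n → List (Vec A n)
vecs L zero    = [] ∷ []
vecs L (suc n) = cartesianProductWith _∷_ L (vecs L n)

-- For d = p - 1 this replaces 1 - s^(p-1) as a polynomial of degree p - 1 that is non-zero modulo p
-- exactly when p divides s; it has natural coefficients.
rising : ℕ → ℕ → ℕ
rising zero    s = 1
rising (suc d) s = (s + suc d) * rising d s

∣-rising : ∀ {p} d {s} t → 1 ≤ t → t ≤ d → p ∣ s + t → p ∣ rising d s
∣-rising zero    (suc t) _ () p∣
∣-rising (suc d) {s} t 1≤t t≤ p∣ with t ≟ suc d
... | yes refl = ∣m⇒∣m*n (rising d s) p∣
... | no  t≢   = ∣n⇒∣m*n (s + suc d) (∣-rising d t 1≤t (≤-pred (≤∧≢⇒< t≤ t≢)) p∣)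

-- With r the non-zero remainder of s modulo p = d + 1, the factor s + (p - r) is a multiple of p.
∤⇒∣-rising : ∀ d {s} → suc d ∤ s → suc d ∣ rising d s
∤⇒∣-rising d {s} ∤s = ∣-rising d (suc d ∸ r) (m<n⇒0<n∸m r<) (lemma r r≢0) (divides (suc (s / suc d)) (begin
    s + (suc d ∸ r)                             ≡⟨ cong (_+ (suc d ∸ r)) (m≡m%n+[m/n]*n s (suc d)) ⟩
    r + s / suc d * suc d + (suc d ∸ r)         ≡⟨ shuffle r (s / suc d * suc d) (suc d ∸ r) ⟩
    (r + (suc d ∸ r)) + s / suc d * suc d       ≡⟨ cong (_+ s / suc d * suc d) (m+[n∸m]≡n (<⇒≤ r<)) ⟩
    suc d + s / suc d * suc d                   ∎))
  where
  open ≡-Reasoning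
  r = s % suc d
  r< : r < suc d
  r< = m%n<n s (suc d)
  r≢0 : r ≢ 0
  r≢0 r≡0 = ∤s (m%n≡0⇒n∣m s (suc d) r≡0)
  lemma : ∀ r → r ≢ 0 → suc d ∸ r ≤ d
  lemma zero    r≢0 = contradiction refl r≢0
  lemma (suc r) _   = m∸n≤m d r
  shuffle : ∀ a b c → a + b + c ≡ a + c + b
  shuffle = solve-∀

∣⇒∤-rising : ∀ {p} → Prime p → ∀ d {s} → d < p → p ∣ s → p ∤ rising d s
∣⇒∤-rising pr zero    _ _   = ∤1 pr
∣⇒∤-rising pr (suc d) d<p p∣s =
  ∤-* pr (λ p∣ → >⇒∤ d<p (∣m+n∣m⇒∣n p∣ p∣s)) (∣⇒∤-rising pr d (<-trans (n<1+n d) d<p) p∣s)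

risings : ∀ {n} → ℕ → Vec ℕ n → Vec ℕ n → Vec ℕ n → ℕ
risings d []       []       []       = 1
risings d (x ∷ xs) (y ∷ ys) (z ∷ zs) = rising d (x + y + z) * risings d xs ys zs

Vanish : ∀ {n} → ℕ → Vec ℕ n → Vec ℕ n → Vec ℕ n → Set
Vanish p x y z = ∀ l → p ∣ lookup x l + lookup y l + lookup z l

∣-risings : ∀ d {n} (x y z : Vec ℕ n) → ¬ Vanish (suc d) x y z → suc d ∣ risings d x y z
∣-risings d []       []       []       ¬v = contradiction (λ ()) ¬v
∣-risings d (x ∷ xs) (y ∷ ys) (z ∷ zs) ¬v with suc d ∣? x + y + z
... | no  ∤s = ∣m⇒∣m*n _ (∤⇒∣-rising d ∤s)
... | yes ∣s = ∣n⇒∣m*n (rising d (x + y + z)) (∣-risings d xs ys zs λ v → ¬v λ { zero → ∣s ; (suc l) → v l })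

∤-risings : ∀ d → Prime (suc d) → ∀ {n} (x y z : Vec ℕ n) → Vanish (suc d) x y z → suc d ∤ risings d x y z
∤-risings d pr []       []       []       v = ∤1 pr
∤-risings d pr (x ∷ xs) (y ∷ ys) (z ∷ zs) v =
  ∤-* pr (∣⇒∤-rising pr d (n<1+n d) (v zero)) (∤-risings d pr xs ys zs (v ∘ suc))

record Term : Set where
  constructor term
  field coef degx degy degz : ℕ
open Term

evaluate : ℕ → ℕ → ℕ → Term → ℕ
evaluate x y z (term c a b e) = c * (x ^ a * (y ^ b * z ^ e))

timesX timesY timesZ : Term → Term
timesX (term c a b e) = term c (suc a) b e
timesY (term c a b e) = term c a (suc b) e
timesZ (term c a b e) = term c a b (suc e)

times : ℕ → Term → Term
times k (term c a b e) = term (k * c) a b e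

-- Like monomials are not collected: each term is classified by its own degrees, and the rank bound
-- counts the distinct low monomials rather than the terms.
expansion : ℕ → List Term
expansion zero    = term 1 0 0 0 ∷ []
expansion (suc d) = map timesX ts ++ map timesY ts ++ map timesZ ts ++ map (times (suc d)) ts
  where ts = expansion d

DegreeAtMost : ℕ → Term → Set
DegreeAtMost d t = degx t + degy t + degz t ≤ d

expansion-degree : ∀ d → All (DegreeAtMost d) (expansion d)
expansion-degree zero    = z≤n ∷ []
expansion-degree (suc d) =
  All.++⁺ (All.map⁺ (All.map s≤s ts))
  (All.++⁺ (All.map⁺ (All.map (λ {t} → subst (_≤ suc d) (sym (cong (_+ degz t) (+-suc (degx t) (degy t)))) ∘ s≤s) ts))
  (All.++⁺ (All.map⁺ (All.map (λ {t} → subst (_≤ suc d) (sym (+-suc (degx t + degy t) (degz t))) ∘ s≤s) ts))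
           (All.map⁺ (All.map m≤n⇒m≤1+n ts))))
  where ts = expansion-degree d

∑-expansion : ∀ d x y z → ∑ (evaluate x y z) (expansion d) ≡ rising d (x + y + z)
∑-expansion zero    x y z = refl
∑-expansion (suc d) x y z = begin
  ∑ ev (map timesX ts ++ map timesY ts ++ map timesZ ts ++ map (times (suc d)) ts)
    ≡⟨ trans (∑-++ ev (map timesX ts) _) (cong (∑ ev (map timesX ts) +_)
       (trans (∑-++ ev (map timesY ts) _) (cong (∑ ev (map timesY ts) +_) (∑-++ ev (map timesZ ts) _)))) ⟩
  ∑ ev (map timesX ts) + (∑ ev (map timesY ts) + (∑ ev (map timesZ ts) + ∑ ev (map (times (suc d)) ts)))
    ≡⟨ cong₂ _+_ (factor x timesX (λ t → lemX x (coef t) (x ^ degx t) (y ^ degy t) (z ^ degz t)))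
       (cong₂ _+_ (factor y timesY (λ t → lemY y (coef t) (x ^ degx t) (y ^ degy t) (z ^ degz t)))
       (cong₂ _+_ (factor z timesZ (λ t → lemZ z (coef t) (x ^ degx t) (y ^ degy t) (z ^ degz t)))
                  (factor (suc d) (times (suc d)) (λ t → *-assoc (suc d) (coef t) _)))) ⟩
  x * S + (y * S + (z * S + suc d * S)) ≡⟨ collect x y z (suc d) S ⟩
  (x + y + z + suc d) * S               ≡⟨ cong ((x + y + z + suc d) *_) (∑-expansion d x y z) ⟩
  (x + y + z + suc d) * rising d (x + y + z) ∎
  where
  open ≡-Reasoning
  ev = evaluate x y z
  ts = expansion d
  S = ∑ ev ts
  factor : ∀ k (f : Term → Term) → (∀ t → ev (f t) ≡ k * ev t) → ∑ ev (map f ts) ≡ k * S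
  factor k f e = trans (∑-map ev f ts) (trans (∑-cong e ts) (∑-*ˡ k ev ts))
  lemX : ∀ k c a b e → c * (k * a * (b * e)) ≡ k * (c * (a * (b * e)))
  lemX = solve-∀
  lemY : ∀ k c a b e → c * (a * (k * b * e)) ≡ k * (c * (a * (b * e)))
  lemY = solve-∀
  lemZ : ∀ k c a b e → c * (a * (b * (k * e))) ≡ k * (c * (a * (b * e)))
  lemZ = solve-∀
  collect : ∀ x y z k s → x * s + (y * s + (z * s + k * s)) ≡ (x + y + z + k) * s
  collect = solve-∀

∏ : ∀ {A : Set} {n} → (A → ℕ) → Vec A n → ℕ
∏ f []       = 1
∏ f (x ∷ xs) = f x * ∏ f xs

∑-vecs : ∀ {A : Set} (f : A → ℕ) L n → ∑ (∏ f) (vecs L n) ≡ ∑ f L ^ n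
∑-vecs f L zero    = refl
∑-vecs f L (suc n) = begin
  ∑ (∏ f) (cartesianProductWith _∷_ L (vecs L n))   ≡⟨ ∑-cartesianProductWith _∷_ (∏ f) L (vecs L n) ⟩
  ∑ (λ x → ∑ (λ xs → f x * ∏ f xs) (vecs L n)) L    ≡⟨ ∑-*-∑ f (∏ f) L (vecs L n) ⟩
  ∑ f L * ∑ (∏ f) (vecs L n)                        ≡⟨ cong (∑ f L *_) (∑-vecs f L n) ⟩
  ∑ f L * ∑ f L ^ n                                 ∎
  where open ≡-Reasoning

monomial : ∀ {n} → Vec ℕ n → Vec ℕ n → ℕ
monomial []       []       = 1
monomial (a ∷ as) (x ∷ xs) = x ^ a * monomial as xs

evaluates : ∀ {n} → Vec ℕ n → Vec ℕ n → Vec ℕ n → Vec Term n → ℕ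
evaluates x y z ts = ∏ coef ts * (monomial (Vec.map degx ts) x * (monomial (Vec.map degy ts) y * monomial (Vec.map degz ts) z))

∑-evaluates : ∀ d {n} (x y z : Vec ℕ n) → ∑ (evaluates x y z) (vecs (expansion d) n) ≡ risings d x y z
∑-evaluates d []       []       []       = refl
∑-evaluates d {suc n} (x ∷ xs) (y ∷ ys) (z ∷ zs) = begin
  ∑ (evaluates (x ∷ xs) (y ∷ ys) (z ∷ zs)) (vecs L (suc n))
    ≡⟨ ∑-cartesianProductWith _∷_ (evaluates (x ∷ xs) (y ∷ ys) (z ∷ zs)) L (vecs L n) ⟩
  ∑ (λ t → ∑ (λ ts → evaluates (x ∷ xs) (y ∷ ys) (z ∷ zs) (t ∷ ts)) (vecs L n)) L
    ≡⟨ ∑-cong (λ t → ∑-cong (λ ts → lemma (coef t) _ (x ^ degx t) _ (y ^ degy t) _ (z ^ degz t) _) (vecs L n)) L ⟩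
  ∑ (λ t → ∑ (λ ts → evaluate x y z t * evaluates xs ys zs ts) (vecs L n)) L
    ≡⟨ ∑-*-∑ (evaluate x y z) (evaluates xs ys zs) L (vecs L n) ⟩
  ∑ (evaluate x y z) L * ∑ (evaluates xs ys zs) (vecs L n)
    ≡⟨ cong₂ _*_ (∑-expansion d x y z) (∑-evaluates d xs ys zs) ⟩
  rising d (x + y + z) * risings d xs ys zs ∎
  where
  open ≡-Reasoning
  L = expansion d
  lemma : ∀ c c′ x x′ y y′ z z′ →
    c * c′ * (x * x′ * (y * y′ * (z * z′))) ≡ c * (x * (y * z)) * (c′ * (x′ * (y′ * z′)))
  lemma = solve-∀

lowDegree : ℕ → ∀ n → List (Vec ℕ n)
lowDegree d n = filter (λ a → 3 * Vec.sum a ≤? n * d) (vecs (upTo (suc d)) n)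

vecs-all : ∀ {A : Set} {P : A → Set} {L} → All P L → ∀ n → All (VecAll P) (vecs L n)
vecs-all all zero    = [] ∷ []
vecs-all all (suc n) = All.cartesianProductWith⁺ (setoid _) (setoid _) _∷_ _ _
  (λ x∈ xs∈ → All.lookup all x∈ ∷ All.lookup (vecs-all all n) xs∈)

∈-vecs : ∀ {A : Set} {L} {n} {xs : Vec A n} → VecAll (_∈ L) xs → xs ∈ vecs L n
∈-vecs []         = here refl
∈-vecs (x∈ ∷ xs∈) = ∈-cartesianProductWith⁺ _∷_ x∈ (∈-vecs xs∈)

∈-lowDegree : ∀ {d n} (deg : Term → ℕ) → (∀ t → DegreeAtMost d t → deg t ≤ d) → {ts : Vec Term n} →
  VecAll (DegreeAtMost d) ts → 3 * Vec.sum (Vec.map deg ts) ≤ n * d → Vec.map deg ts ∈ lowDegree d n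
∈-lowDegree {d} deg deg≤ all = ∈-filter⁺ _ (∈-vecs (entries all))
  where
  entries : ∀ {n} {ts : Vec Term n} → VecAll (DegreeAtMost d) ts → VecAll (_∈ upTo (suc d)) (Vec.map deg ts)
  entries []                = []
  entries (_∷_ {x = t} p ps) = ∈-upTo⁺ (s≤s (deg≤ t p)) ∷ entries ps

total-degree : ∀ {d n} {ts : Vec Term n} → VecAll (DegreeAtMost d) ts →
  Vec.sum (Vec.map degx ts) + Vec.sum (Vec.map degy ts) + Vec.sum (Vec.map degz ts) ≤ n * d
total-degree []                 = z≤n
total-degree {d} {suc n} {t ∷ ts} (p ∷ ps) = begin
  (degx t + X) + (degy t + Y) + (degz t + Z)     ≡⟨ lemma (degx t) X (degy t) Y (degz t) Z ⟩
  (degx t + degy t + degz t) + (X + Y + Z)       ≤⟨ +-mono-≤ p (total-degree ps) ⟩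
  d + n * d                                      ∎
  where
  open ≤-Reasoning
  X = Vec.sum (Vec.map degx ts)
  Y = Vec.sum (Vec.map degy ts)
  Z = Vec.sum (Vec.map degz ts)
  lemma : ∀ a b c d e f → a + b + (c + d) + (e + f) ≡ a + c + e + (b + d + f)
  lemma = solve-∀

one-third : ∀ a b c {N} → a + b + c ≤ N → 3 * a ≤ N ⊎ 3 * b ≤ N ⊎ 3 * c ≤ N
one-third a b c {N} abc≤N with 3 * a ≤? N | 3 * b ≤? N | 3 * c ≤? N
... | yes p | _     | _     = inj₁ p
... | no  _ | yes q | _     = inj₂ (inj₁ q)
... | no  _ | no  _ | yes r = inj₂ (inj₂ r)
... | no  p | no  q | no  r = contradiction (begin-strict
  3 * N                      ≡⟨ split N ⟩
  N + N + N                  <⟨ +-mono-< (+-mono-< (≰⇒> p) (≰⇒> q)) (≰⇒> r) ⟩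
  3 * a + 3 * b + 3 * c      ≡⟨ join a b c ⟩
  3 * (a + b + c)            ≤⟨ *-monoʳ-≤ 3 abc≤N ⟩
  3 * N                      ∎) (<-irrefl refl)
  where
  open ≤-Reasoning
  split : ∀ n → 3 * n ≡ n + n + n
  split = solve-∀
  join : ∀ a b c → 3 * a + 3 * b + 3 * c ≡ 3 * (a + b + c)
  join = solve-∀

LowSomewhere : ∀ d {n} → Vec Term n → Set
LowSomewhere d {n} ts =
  Vec.map degx ts ∈ lowDegree d n ⊎ Vec.map degy ts ∈ lowDegree d n ⊎ Vec.map degz ts ∈ lowDegree d n

expansion-lowSomewhere : ∀ d n → All (LowSomewhere d) (vecs (expansion d) n)
expansion-lowSomewhere d n = All.map (λ {ts} all → classify ts all (one-third (Vec.sum (Vec.map degx ts)) (Vec.sum (Vec.map degy ts)) _ (total-degree all)))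
                                     (vecs-all (expansion-degree d) n)
  where
  low : (Term → ℕ) → Vec Term n → Set
  low deg ts = 3 * Vec.sum (Vec.map deg ts) ≤ n * d
  classify : ∀ ts → VecAll (DegreeAtMost d) ts → low degx ts ⊎ low degy ts ⊎ low degz ts → LowSomewhere d ts
  classify ts all (inj₁ low)        = inj₁ (∈-lowDegree degx (λ t → ≤-trans (m≤n⇒m≤n+o (degz t) (m≤m+n (degx t) (degy t)))) all low)
  classify ts all (inj₂ (inj₁ low)) = inj₂ (inj₁ (∈-lowDegree degy (λ t → ≤-trans (m≤n⇒m≤n+o (degz t) (m≤n+m (degy t) (degx t)))) all low))
  classify ts all (inj₂ (inj₂ low)) = inj₂ (inj₂ (∈-lowDegree degz (λ t → ≤-trans (m≤n+m (degz t) (degx t + degy t))) all low))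

-- Slice rank

-- The shape of the tensor after contraction of its third index: `D₁` holds the terms of low degree
-- in x, `D₂` those of low degree in y, and `D₃` those of low degree in z, which the contraction has
-- killed modulo p.
Splits : ∀ {I J : Set} → ℕ → List (I → ℕ) → List (J → ℕ) → (I → J → ℕ) → Set
Splits {I} {J} p us vs E = ∃₂ λ D₁ D₂ → ∃ λ (D₃ : I → J → ℕ) → (∀ i j → E i j ≡ D₁ i j + D₂ i j + D₃ i j) ×
  Span us D₁ × Span vs (flip D₂) × (∀ i j → p ∣ D₃ i j)

span-split : ∀ {T I J : Set} {p} (us : List (I → ℕ)) (vs : List (J → ℕ)) (s : T → ℕ) (u : T → I → ℕ) (v : T → J → ℕ) {ts} →
  All (λ t → u t ∈ us ⊎ v t ∈ vs ⊎ p ∣ s t) ts → Splits p us vs (λ i j → ∑ (λ t → s t * (u t i * v t j)) ts)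
span-split us vs s u v [] = _ , _ , (λ _ _ → 0) , (λ _ _ → refl) , span-0 us , span-0 vs , (λ _ _ → _ ∣0)
span-split {p = p} us vs s u v (_∷_ {x = t} {ts} class all) with span-split us vs s u v all
... | D₁ , D₂ , D₃ , eq , sp₁ , sp₂ , p∣D₃ = add class
  where
  add : u t ∈ us ⊎ v t ∈ vs ⊎ p ∣ s t → Splits p us vs (λ i j → ∑ (λ t → s t * (u t i * v t j)) (t ∷ ts))
  add (inj₁ u∈) = _ , _ , D₃ ,
    (λ i j → trans (cong (s t * (u t i * v t j) +_) (eq i j)) (lemma (s t) (u t i) (v t j) (D₁ i j) (D₂ i j) (D₃ i j))) ,
    span-+ us sp₁ (span-∈ u∈ (λ j → s t * v t j)) , sp₂ , p∣D₃
    where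
    lemma : ∀ s u v a b c → s * (u * v) + (a + b + c) ≡ (a + u * (s * v)) + b + c
    lemma = solve-∀
  add (inj₂ (inj₁ v∈)) = _ , _ , D₃ ,
    (λ i j → trans (cong (s t * (u t i * v t j) +_) (eq i j)) (lemma (s t) (u t i) (v t j) (D₁ i j) (D₂ i j) (D₃ i j))) ,
    sp₁ , span-+ vs sp₂ (span-∈ v∈ (λ i → s t * u t i)) , p∣D₃
    where
    lemma : ∀ s u v a b c → s * (u * v) + (a + b + c) ≡ a + (b + v * (s * u)) + c
    lemma = solve-∀
  add (inj₂ (inj₂ p∣s)) = _ , _ , (λ i j → s t * (u t i * v t j) + D₃ i j) ,
    (λ i j → trans (cong (s t * (u t i * v t j) +_) (eq i j)) (lemma (s t * (u t i * v t j)) (D₁ i j) (D₂ i j) (D₃ i j))) ,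
    sp₁ , sp₂ , (λ i j → ∣m∣n⇒∣m+n (∣m⇒∣m*n _ p∣s) (p∣D₃ i j))
    where
    lemma : ∀ x a b c → x + (a + b + c) ≡ a + b + (x + c)
    lemma = solve-∀

unique-⊆ : ∀ {A : Set} {xs ys : List A} → xs ⊆ ys → Unique ys → Unique xs
unique-⊆ []          _            = []
unique-⊆ (y ∷ʳ xs⊆) (_ ∷ unique)  = unique-⊆ xs⊆ unique
unique-⊆ (refl ∷ xs⊆) (y∉ ∷ unique) = All-resp-⊆ xs⊆ y∉ ∷ unique-⊆ xs⊆ unique

module _ (d : ℕ) (pr : Prime (suc d)) {n : ℕ} {I : Set} (x y z : I → Vec ℕ n)
  (diagonal : ∀ i → Vanish (suc d) (x i) (y i) (z i))
  (off-diagonal : ∀ i j k → Vanish (suc d) (x i) (y j) (z k) → i ≡ j × j ≡ k) where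

  private
    p = suc d
    M = lowDegree d n

    tensor : I → I → I → ℕ
    tensor i j k = risings d (x i) (y j) (z k)

  -- Contract the third index with weights that annihilate the low monomials in z and live on at
  -- least |xs| - |M| indices. The resulting matrix is diagonal modulo p with non-zero entries on
  -- that support, so it has full rank there. Its x and y parts have rank at most |M| each, whence
  -- |xs| - |M| ≤ 2 |M|.
  slice-rank : ∀ xs → Unique xs → length xs ≤ 3 * length M
  slice-rank xs unique with kernel pr xs (map (λ c k → monomial c (z k)) M)
  ... | ws , ws⊆ , ws∤ , z-killed , ws-len = bound
    where
    us = map (λ a i → monomial a (x i)) M
    vs = map (λ b j → monomial b (y j)) M

    D : I → I → ℕ
    D i j = tensor i j · ws

    u v : Vec Term n → I → ℕ
    u ts i = monomial (Vec.map degx ts) (x i)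
    v ts j = monomial (Vec.map degy ts) (y j)
    s : Vec Term n → ℕ
    s ts = ∏ coef ts * (λ k → monomial (Vec.map degz ts) (z k)) · ws

    D≡∑ : ∀ i j → D i j ≡ ∑ (λ ts → s ts * (u ts i * v ts j)) (vecs (expansion d) n)
    D≡∑ i j = begin
      tensor i j · ws
        ≡⟨ ·-cong (λ k → sym (∑-evaluates d (x i) (y j) (z k))) ws ⟩
      (λ k → ∑ (evaluates (x i) (y j) (z k)) (vecs (expansion d) n)) · ws
        ≡⟨ ·-∑ (λ ts k → evaluates (x i) (y j) (z k) ts) (vecs (expansion d) n) ws ⟩
      ∑ (λ ts → (λ k → evaluates (x i) (y j) (z k) ts) · ws) (vecs (expansion d) n)
        ≡⟨ ∑-cong (λ ts → trans (·-cong (λ k → pull (∏ coef ts) (u ts i) (v ts j) _) ws)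
             (trans (·-* (∏ coef ts * (u ts i * v ts j)) _ ws) (push (∏ coef ts) (u ts i * v ts j) _))) (vecs (expansion d) n) ⟩
      ∑ (λ ts → s ts * (u ts i * v ts j)) (vecs (expansion d) n) ∎
      where
      open ≡-Reasoning
      pull : ∀ c u v z → c * (u * (v * z)) ≡ c * (u * v) * z
      pull = solve-∀
      push : ∀ c q z → c * q * z ≡ c * z * q
      push = solve-∀

    classes : All (λ ts → u ts ∈ us ⊎ v ts ∈ vs ⊎ p ∣ s ts) (vecs (expansion d) n)
    classes = All.map classify (expansion-lowSomewhere d n)
      where
      classify : ∀ {ts} → LowSomewhere d ts → u ts ∈ us ⊎ v ts ∈ vs ⊎ p ∣ s ts
      classify (inj₁ a∈)               = inj₁ (∈-map⁺ _ a∈)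
      classify (inj₂ (inj₁ b∈))        = inj₂ (inj₁ (∈-map⁺ _ b∈))
      classify {ts} (inj₂ (inj₂ c∈))   = inj₂ (inj₂ (∣n⇒∣m*n (∏ coef ts) (All.lookup z-killed (∈-map⁺ _ c∈))))

    off : ∀ i j k → ¬ (i ≡ j × j ≡ k) → p ∣ tensor i j k
    off i j k ≢ = ∣-risings d (x i) (y j) (z k) (≢ ∘ off-diagonal i j k)

    bound : length xs ≤ 3 * length M
    bound with span-split us vs s u v classes
    ... | D₁ , D₂ , D₃ , D≡ , sp₁ , sp₂ , p∣D₃ with span-dual us sp₁
    ...   | Gs , Gs-len , Gs-kill with kernel pr (support ws) (Gs ++ vs)
    ...     | [] , _ , _ , _ , len = begin
      length xs                                    ≤⟨ ws-len ⟩
      length ws + length (map _ M)                 ≡⟨ cong (length ws +_) (length-map _ M) ⟩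
      length ws + length M                         ≡⟨ cong (_+ length M) (length-map proj₁ ws) ⟨
      length (support ws) + length M               ≤⟨ +-monoˡ-≤ (length M) len ⟩
      length (Gs ++ vs) + length M                 ≡⟨ cong (_+ length M) (length-++ Gs) ⟩
      length Gs + length vs + length M             ≡⟨ cong₂ (λ a b → a + b + length M) (trans Gs-len (length-map _ M)) (length-map _ M) ⟩
      length M + length M + length M               ≡⟨ triple (length M) ⟩
      3 * length M                                 ∎
      where
      open ≤-Reasoning
      triple : ∀ m → m + m + m ≡ 3 * m
      triple = solve-∀
    -- A non-zero vector on the support that annihilates both parts: row `i₀` of the matrix sends it
    -- to zero modulo p, yet only the diagonal entry of that row contributes and it is non-zero.
    ...     | gs@((i₀ , _) ∷ _) , gs⊆ , gs∤ , killed , _ =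
      contradiction p∣row (·-isolate pr gs unique-gs gs∤ (here refl) D-diag D-off)
      where
      unique-ws = unique-⊆ ws⊆ unique
      unique-gs = unique-⊆ gs⊆ unique-ws
      i₀∈ : i₀ ∈ support ws
      i₀∈ = ⊆-lookup gs⊆ (here refl)
      D-diag : p ∤ D i₀ i₀
      D-diag = ·-isolate pr ws unique-ws ws∤ i₀∈ (∤-risings d pr (x i₀) (y i₀) (z i₀) (diagonal i₀))
        (λ k k≢ → off i₀ i₀ k (λ (_ , eq) → k≢ (sym eq)))
      D-off : ∀ j → j ≢ i₀ → p ∣ D i₀ j
      D-off j j≢ = ·-∣ (λ k → off i₀ j k (λ (eq , _) → j≢ (sym eq))) ws
      p∣row : p ∣ D i₀ · gs
      p∣row = subst (p ∣_) (sym (begin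
        D i₀ · gs                                       ≡⟨ ·-cong (λ j → trans (D≡∑ i₀ j) (D≡ i₀ j)) gs ⟩
        (λ j → D₁ i₀ j + D₂ i₀ j + D₃ i₀ j) · gs        ≡⟨ ·-+ _ (D₃ i₀) gs ⟩
        (λ j → D₁ i₀ j + D₂ i₀ j) · gs + D₃ i₀ · gs     ≡⟨ cong (_+ D₃ i₀ · gs) (·-+ (D₁ i₀) (D₂ i₀) gs) ⟩
        D₁ i₀ · gs + D₂ i₀ · gs + D₃ i₀ · gs            ∎))
        (∣m∣n⇒∣m+n (∣m∣n⇒∣m+n (Gs-kill gs (All.++⁻ˡ Gs killed) i₀) (span-kill vs sp₂ gs (All.++⁻ʳ Gs killed) i₀))
                   (·-∣ (p∣D₃ i₀) gs))
        where open ≡-Reasoning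

-- Counting monomials of low degree

∑-⊆ : ∀ {A : Set} (f : A → ℕ) {xs ys} → xs ⊆ ys → ∑ f xs ≤ ∑ f ys
∑-⊆ f []           = z≤n
∑-⊆ f (y ∷ʳ xs⊆)   = m≤n⇒m≤o+n (f y) (∑-⊆ f xs⊆)
∑-⊆ f (refl ∷ xs⊆) = +-monoʳ-≤ (f _) (∑-⊆ f xs⊆)

∑-reverse-upTo : ∀ (f : ℕ → ℕ) d → ∑ (λ a → f (d ∸ a)) (upTo (suc d)) ≡ ∑ f (upTo (suc d))
∑-reverse-upTo f d = begin
  ∑ (λ a → f (d ∸ a)) (upTo (suc d))      ≡⟨ ∑-map f (d ∸_) (upTo (suc d)) ⟨
  ∑ f (map (d ∸_) (upTo (suc d)))         ≡⟨ cong (∑ f) (trans (map-applyUpTo id (d ∸_) (suc d)) (backwards d)) ⟩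
  ∑ f (downFrom (suc d))                  ≡⟨ cong (∑ f) (reverse-applyUpTo id (suc d)) ⟨
  ∑ f (reverse (upTo (suc d)))            ≡⟨ ∑-↭ f (↭-reverse (upTo (suc d))) ⟩
  ∑ f (upTo (suc d))                      ∎
  where
  open ≡-Reasoning
  backwards : ∀ d → applyUpTo (d ∸_) (suc d) ≡ downFrom (suc d)
  backwards zero    = refl
  backwards (suc d) = cong (suc d ∷_) (backwards d)

-- (U / V)^a multiplied by V^d to clear the denominator.
weight : ℕ → ℕ → ℕ → ℕ → ℕ
weight U V d a = U ^ a * V ^ (d ∸ a)

weights : ℕ → ℕ → ℕ → ℕ
weights U V d = ∑ (weight U V d) (upTo (suc d))

-- Chebyshev's inequality, applied to the pair a, d ∸ a.
weights-bound : ∀ {U V} d → U ≤ V → 2 * weights U V d ≤ suc d * (U ^ d + V ^ d)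
weights-bound {U} {V} d U≤V = begin
  2 * weights U V d                                          ≡⟨ cong (weights U V d +_) (+-identityʳ _) ⟩
  weights U V d + weights U V d                              ≡⟨ cong (weights U V d +_) (∑-reverse-upTo W d) ⟨
  weights U V d + ∑ (λ a → W (d ∸ a)) (upTo (suc d))         ≡⟨ ∑-+ W (λ a → W (d ∸ a)) (upTo (suc d)) ⟨
  ∑ (λ a → W a + W (d ∸ a)) (upTo (suc d))                   ≤⟨ ∑-mono (All.applyUpTo⁺₁ id (suc d) (λ a<1+d → pair (≤-pred a<1+d))) ⟩
  ∑ (λ _ → U ^ d + V ^ d) (upTo (suc d))                     ≡⟨ ∑-const _ (upTo (suc d)) ⟩
  length (upTo (suc d)) * (U ^ d + V ^ d)                    ≡⟨ cong (_* (U ^ d + V ^ d)) (length-upTo (suc d)) ⟩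
  suc d * (U ^ d + V ^ d)                                    ∎
  where
  open ≤-Reasoning
  W = weight U V d
  chebyshev : ∀ {x x′ y y′} → x ≤ x′ → y ≤ y′ → x * y′ + y * x′ ≤ x * y + x′ * y′
  chebyshev {x} {x′} {y} {y′} x≤ y≤ with s , refl ← m≤n⇒∃[o]m+o≡n x≤ | t , refl ← m≤n⇒∃[o]m+o≡n y≤ =
    subst (x * (y + t) + y * (x + s) ≤_) (lemma x y s t) (m≤m+n _ (s * t))
    where
    lemma : ∀ x y s t → x * (y + t) + y * (x + s) + s * t ≡ x * y + (x + s) * (y + t)
    lemma = solve-∀
  pair : ∀ {a} → a ≤ d → W a + W (d ∸ a) ≤ U ^ d + V ^ d
  pair {a} a≤d = begin
    U ^ a * V ^ b + U ^ b * V ^ (d ∸ b)        ≡⟨ cong (λ e → U ^ a * V ^ b + U ^ b * V ^ e) (m∸[m∸n]≡n a≤d) ⟩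
    U ^ a * V ^ b + U ^ b * V ^ a              ≤⟨ chebyshev (^-monoˡ-≤ a U≤V) (^-monoˡ-≤ b U≤V) ⟩
    U ^ a * U ^ b + V ^ a * V ^ b              ≡⟨ cong₂ _+_ (^-distribˡ-+-* U a b) (^-distribˡ-+-* V a b) ⟨
    U ^ (a + b) + V ^ (a + b)                  ≡⟨ cong (λ e → U ^ e + V ^ e) (m+[n∸m]≡n a≤d) ⟩
    U ^ d + V ^ d                              ∎
    where b = d ∸ a

∏-weight : ∀ U V d {n} {as : Vec ℕ n} → VecAll (_≤ d) as →
  ∏ (weight U V d) as * V ^ Vec.sum as ≡ U ^ Vec.sum as * V ^ (n * d)
∏-weight U V d []  = refl
∏-weight U V d {suc n} {a ∷ as} (a≤d ∷ all) = begin
  weight U V d a * ∏ (weight U V d) as * V ^ (a + s)                  ≡⟨ cong (weight U V d a * ∏ (weight U V d) as *_) (^-distribˡ-+-* V a s) ⟩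
  U ^ a * V ^ (d ∸ a) * ∏ (weight U V d) as * (V ^ a * V ^ s)         ≡⟨ lemma (U ^ a) (V ^ (d ∸ a)) _ (V ^ a) (V ^ s) ⟩
  U ^ a * (V ^ a * V ^ (d ∸ a)) * (∏ (weight U V d) as * V ^ s)       ≡⟨ cong₂ (λ x y → U ^ a * x * y)
       (trans (sym (^-distribˡ-+-* V a (d ∸ a))) (cong (V ^_) (m+[n∸m]≡n a≤d))) (∏-weight U V d all) ⟩
  U ^ a * V ^ d * (U ^ s * V ^ (n * d))                               ≡⟨ lemma₂ (U ^ a) (V ^ d) (U ^ s) (V ^ (n * d)) ⟩
  U ^ a * U ^ s * (V ^ d * V ^ (n * d))                               ≡⟨ cong₂ _*_ (^-distribˡ-+-* U a s) (^-distribˡ-+-* V d (n * d)) ⟨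
  U ^ (a + s) * V ^ (d + n * d)                                       ∎
  where
  open ≡-Reasoning
  s = Vec.sum as
  lemma : ∀ u v p w z → u * v * p * (w * z) ≡ u * (w * v) * (p * z)
  lemma = solve-∀
  lemma₂ : ∀ a b c d → a * b * (c * d) ≡ a * c * (b * d)
  lemma₂ = solve-∀

^-distribʳ-* : ∀ n x y → (x * y) ^ n ≡ x ^ n * y ^ n
^-distribʳ-* zero    x y = refl
^-distribʳ-* (suc n) x y = trans (cong (x * y *_) (^-distribʳ-* n x y)) (lemma x y (x ^ n) (y ^ n))
  where
  lemma : ∀ a b c d → a * b * (c * d) ≡ a * c * (b * d)
  lemma = solve-∀

-- Since u ≤ v and 3 · degree ≤ n d, the weight (u / v)^(3 · degree) is at least (u / v)^(n d).
-- Multiplied by v^(3 n d) this is u^(n d) v^(2 n d). The cubes keep n d / 3 out of the exponents.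
∏-weight-lowDegree : ∀ {u v} .{{_ : NonZero v}} → u ≤ v → ∀ d {n} {as : Vec ℕ n} → VecAll (_≤ d) as → 3 * Vec.sum as ≤ n * d →
  (u ^ d * v ^ (2 * d)) ^ n ≤ ∏ (weight (u ^ 3) (v ^ 3) d) as
∏-weight-lowDegree {u} {v} u≤v d {n} {as} all low with r , eq ← m≤n⇒∃[o]m+o≡n low =
  *-cancelʳ-≤ _ _ ((v ^ 3) ^ s) {{m^n≢0 (v ^ 3) s {{m^n≢0 v 3}}}} (begin
    (u ^ d * v ^ (2 * d)) ^ n * (v ^ 3) ^ s               ≡⟨ cong₂ _*_ (^-distribʳ-* n (u ^ d) (v ^ (2 * d))) (^-*-assoc v 3 s) ⟩
    (u ^ d) ^ n * (v ^ (2 * d)) ^ n * v ^ (3 * s)         ≡⟨ cong₂ (λ x y → x * y * v ^ (3 * s)) (^-*-assoc u d n) (^-*-assoc v (2 * d) n) ⟩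
    u ^ (d * n) * v ^ (2 * d * n) * v ^ (3 * s)           ≡⟨ cong₂ (λ x y → u ^ x * y * v ^ (3 * s)) dn≡ (cong (v ^_) (trans (*-assoc 2 d n) (cong (2 *_) dn≡))) ⟩
    u ^ (3 * s + r) * v ^ (2 * N) * v ^ (3 * s)           ≡⟨ cong (λ x → x * v ^ (2 * N) * v ^ (3 * s)) (^-distribˡ-+-* u (3 * s) r) ⟩
    u ^ (3 * s) * u ^ r * v ^ (2 * N) * v ^ (3 * s)       ≡⟨ lemma (u ^ (3 * s)) (u ^ r) (v ^ (2 * N)) (v ^ (3 * s)) ⟩
    u ^ (3 * s) * (v ^ (3 * s) * u ^ r * v ^ (2 * N))     ≤⟨ *-monoʳ-≤ (u ^ (3 * s)) (*-monoˡ-≤ (v ^ (2 * N)) (*-monoʳ-≤ (v ^ (3 * s)) (^-monoˡ-≤ r u≤v))) ⟩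
    u ^ (3 * s) * (v ^ (3 * s) * v ^ r * v ^ (2 * N))     ≡⟨ cong (λ x → u ^ (3 * s) * (x * v ^ (2 * N))) (^-distribˡ-+-* v (3 * s) r) ⟨
    u ^ (3 * s) * (v ^ N * v ^ (2 * N))                   ≡⟨ cong₂ _*_ (^-*-assoc u 3 s) (^-distribˡ-+-* v N (2 * N)) ⟨
    (u ^ 3) ^ s * v ^ (3 * N)                             ≡⟨ cong ((u ^ 3) ^ s *_) (trans (^-*-assoc v 3 (n * d)) (cong (λ x → v ^ (3 * x)) (sym eq))) ⟨
    (u ^ 3) ^ s * (v ^ 3) ^ (n * d)                       ≡⟨ ∏-weight (u ^ 3) (v ^ 3) d all ⟨
    ∏ (weight (u ^ 3) (v ^ 3) d) as * (v ^ 3) ^ s         ∎)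
  where
  open ≤-Reasoning
  s = Vec.sum as
  N = 3 * s + r
  dn≡ : d * n ≡ N
  dn≡ = trans (*-comm d n) (sym eq)
  lemma : ∀ a b c e → a * b * c * e ≡ a * (e * b * c)
  lemma = solve-∀

-- A Chernoff bound: each monomial is weighted by (u / v)^(3 · degree − n d), which is at least 1 on lowDegree.
lowDegree-count : ∀ {u v} .{{_ : NonZero v}} → u ≤ v → ∀ d n →
  length (lowDegree d n) * (u ^ d * v ^ (2 * d)) ^ n ≤ weights (u ^ 3) (v ^ 3) d ^ n
lowDegree-count {u} {v} u≤v d n = begin
  length M * B ^ n          ≡⟨ ∑-const (B ^ n) M ⟨
  ∑ (λ _ → B ^ n) M         ≤⟨ ∑-mono (All.zipWith (λ (all , low) → ∏-weight-lowDegree u≤v d all low)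
                                 (All.filter⁺ low? (vecs-all (All.applyUpTo⁺₁ id (suc d) ≤-pred) n) , All.all-filter low? all-exps)) ⟩
  ∑ (∏ W) M                 ≤⟨ ∑-⊆ (∏ W) (filter-⊆ low? all-exps) ⟩
  ∑ (∏ W) all-exps          ≡⟨ ∑-vecs W (upTo (suc d)) n ⟩
  weights (u ^ 3) (v ^ 3) d ^ n ∎
  where
  open ≤-Reasoning
  M = lowDegree d n
  B = u ^ d * v ^ (2 * d)
  W = weight (u ^ 3) (v ^ 3) d
  all-exps = vecs (upTo (suc d)) n
  low? : (a : Vec ℕ n) → Dec (3 * Vec.sum a ≤ n * d)
  low? a = 3 * Vec.sum a ≤? n * d

-- The rate of growth, compared with p

bernoulli-suc : ∀ u d → suc u ^ d * suc u ≤ u ^ d * suc u + d * suc u ^ d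
bernoulli-suc u zero    = m≤m+n (1 * suc u) 0
bernoulli-suc u (suc d) = begin
  v * v ^ d * v                               ≡⟨ *-assoc v (v ^ d) v ⟩
  v * (v ^ d * v)                             ≤⟨ *-monoʳ-≤ v (bernoulli-suc u d) ⟩
  v * (u ^ d * v + d * v ^ d)                 ≡⟨ lemma u (u ^ d) d (v ^ d) ⟩
  u * u ^ d * v + (v * u ^ d + d * (v * v ^ d)) ≤⟨ +-monoʳ-≤ (u * u ^ d * v) (+-monoˡ-≤ (d * (v * v ^ d)) (*-monoʳ-≤ v (^-monoˡ-≤ d (n≤1+n u)))) ⟩
  u * u ^ d * v + (v * v ^ d + d * (v * v ^ d)) ∎
  where
  open ≤-Reasoning
  v = suc u
  lemma : ∀ u x d y → suc u * (x * suc u + d * y) ≡ u * x * suc u + (suc u * x + d * (suc u * y))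
  lemma = solve-∀

-- The rate γ = A / B obtained from the Chernoff parameter u / v with v = 3 d, u = v − 1.
module Rate (d₀ : ℕ) where
  d u v U V A B : ℕ
  d = suc d₀
  v = 3 * d
  u = pred v
  U = u ^ d
  V = v ^ d
  A = weights (u ^ 3) (v ^ 3) d
  B = u ^ d * v ^ (2 * d)

  -- Bernoulli: (1 - 1/v)^d ≥ 1 - d/v, which is 2/3 because v = 3 d.
  2V≤3U : 2 * V ≤ 3 * U
  2V≤3U = *-cancelˡ-≤ d (+-cancelʳ-≤ (d * V) _ _ (begin
    d * (2 * V) + d * V         ≡⟨ lemma₁ d V ⟩
    V * (3 * d)                 ≤⟨ bernoulli-suc u d ⟩
    U * (3 * d) + d * V         ≡⟨ cong (_+ d * V) (lemma₂ d U) ⟩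
    d * (3 * U) + d * V         ∎))
    where
    open ≤-Reasoning
    lemma₁ : ∀ d V → d * (2 * V) + d * V ≡ V * (3 * d)
    lemma₁ = solve-∀
    lemma₂ : ∀ d U → U * (3 * d) ≡ d * (3 * U)
    lemma₂ = solve-∀

  U<V : U < V
  U<V = ^-monoˡ-< d (n<1+n u)

  u>0 : 0 < u
  u>0 = ≤-trans (s≤s z≤n) (m≤n+m (2 * d) d₀)

  B≡UV² : B ≡ U * V ^ 2
  B≡UV² = cong (U *_) (trans (cong (v ^_) (*-comm 2 d)) (sym (^-*-assoc v d 2)))

  cube : ∀ w → (w ^ 3) ^ d ≡ (w ^ d) ^ 3
  cube w = trans (^-*-assoc w 3 d) (trans (cong (w ^_) (*-comm 3 d)) (sym (^-*-assoc w d 3)))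

  U>0 : 0 < U
  U>0 = m^n>0 u {{>-nonZero u>0}} d

  -- For x = U / V the claim is x³ - 2x + 1 = (x - 1)(x² + x - 1) < 0, true between (√5 - 1) / 2 =
  -- 0.618... and 1. The bound x ≥ 2/3 lies inside this range.
  U³+V³<2UV² : U ^ 3 + V ^ 3 < 2 * (U * V ^ 2)
  U³+V³<2UV² with e , eq ← m≤n⇒∃[o]m+o≡n U<V = subst (λ V → U ^ 3 + V ^ 3 < 2 * (U * V ^ 2)) eq′
      -- With V = U + t and the common part `K` removed, what remains is t (U t + t²) < t U². The
      -- factor 4 makes 2 t ≤ U applicable to both summands.
      (*-cancelˡ-< 4 _ _ (begin-strict
        4 * (U ^ 3 + (U + t) ^ 3)                         ≡⟨ expand₁ U t ⟩
        K + t * (4 * (U * t) + 4 * (t * t))               <⟨ +-monoʳ-< K (*-monoʳ-< t (+-mono-≤-< Ut≤ tt<)) ⟩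
        K + t * (2 * (U * U) + 2 * (U * U))               ≡⟨ expand₂ U t ⟩
        4 * (2 * (U * (U + t) ^ 2))                       ∎))
    where
    open ≤-Reasoning
    t = suc e
    K = 8 * (U * U * U) + 12 * (U * U * t) + 8 * (U * t * t)
    eq′ : U + t ≡ V
    eq′ = trans (+-suc U e) eq
    2t≤U : 2 * t ≤ U
    2t≤U = +-cancelˡ-≤ (2 * U) _ _ (begin
      2 * U + 2 * t   ≡⟨ *-distribˡ-+ 2 U t ⟨
      2 * (U + t)     ≡⟨ cong (2 *_) eq′ ⟩
      2 * V           ≤⟨ 2V≤3U ⟩
      3 * U           ≡⟨ +-comm U (2 * U) ⟩
      2 * U + U       ∎)
    Ut≤ : 4 * (U * t) ≤ 2 * (U * U)
    Ut≤ = begin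
      4 * (U * t)       ≡⟨ lemma U t ⟩
      2 * (U * (2 * t)) ≤⟨ *-monoʳ-≤ 2 (*-monoʳ-≤ U 2t≤U) ⟩
      2 * (U * U)       ∎
      where
      lemma : ∀ U t → 4 * (U * t) ≡ 2 * (U * (2 * t))
      lemma = solve-∀
    tt< : 4 * (t * t) < 2 * (U * U)
    tt< = begin-strict
      4 * (t * t)         ≡⟨ lemma t ⟩
      (2 * t) * (2 * t)   ≤⟨ *-mono-≤ 2t≤U 2t≤U ⟩
      U * U               <⟨ m<n+m (U * U) (*-mono-< U>0 U>0) ⟩
      U * U + U * U       ≡⟨ cong (U * U +_) (+-identityʳ (U * U)) ⟨
      2 * (U * U)         ∎
      where
      lemma : ∀ t → 4 * (t * t) ≡ (2 * t) * (2 * t)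
      lemma = solve-∀
    expand₁ : ∀ U t → 4 * (U * (U * (U * 1)) + (U + t) * ((U + t) * ((U + t) * 1))) ≡
      8 * (U * U * U) + 12 * (U * U * t) + 8 * (U * t * t) + t * (4 * (U * t) + 4 * (t * t))
    expand₁ = solve-∀
    expand₂ : ∀ U t → 8 * (U * U * U) + 12 * (U * U * t) + 8 * (U * t * t) + t * (2 * (U * U) + 2 * (U * U)) ≡
      4 * (2 * (U * ((U + t) * ((U + t) * 1))))
    expand₂ = solve-∀

  -- At u = v the quotient A / B would be exactly p. Lowering u / v lowers it at first, since the
  -- mean exponent d / 2 exceeds d / 3; the chosen parameter is close enough to 1.
  A<pB : A < suc d * B
  A<pB = *-cancelˡ-< 2 _ _ (begin-strict
    2 * A                                       ≤⟨ weights-bound d (^-monoˡ-≤ 3 (n≤1+n u)) ⟩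
    suc d * ((u ^ 3) ^ d + (v ^ 3) ^ d)         ≡⟨ cong (suc d *_) (cong₂ _+_ (cube u) (cube v)) ⟩
    suc d * (U ^ 3 + V ^ 3)                     <⟨ *-monoʳ-< (suc d) U³+V³<2UV² ⟩
    suc d * (2 * (U * V ^ 2))                   ≡⟨ cong (λ b → suc d * (2 * b)) B≡UV² ⟨
    suc d * (2 * B)                             ≡⟨ lemma (suc d) B ⟩
    2 * (suc d * B)                             ∎)
    where
    open ≤-Reasoning
    lemma : ∀ p b → p * (2 * b) ≡ 2 * (p * b)
    lemma = solve-∀

  -- Gives c > 1: the summand of exponent 0, which is V³, already exceeds B = U V².
  B<A : B < A
  B<A = begin-strict
    B                     ≡⟨ B≡UV² ⟩
    U * V ^ 2             <⟨ *-monoˡ-< (V ^ 2) {{m^n≢0 V 2 {{m^n≢0 v d}}}} U<V ⟩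
    V ^ 3                 ≡⟨ trans (+-identityʳ _) (cube v) ⟨
    weight (u ^ 3) (v ^ 3) d 0   ≤⟨ m≤m+n _ _ ⟩
    A                     ∎
    where open ≤-Reasoning

  B>0 : 0 < B
  B>0 = *-mono-< U>0 (m^n>0 v (2 * d))

  count : ∀ n → length (lowDegree d n) * B ^ n ≤ A ^ n
  count = lowDegree-count (n≤1+n u) d

-- Progression-free families and their powers

bernoulli : ∀ y r → y ^ r * (y + r) ≤ suc y ^ r * y
bernoulli y zero    = ≤-reflexive (cong (1 *_) (+-identityʳ y))
bernoulli y (suc r) = begin
  y * y ^ r * (y + suc r)                   ≡⟨ lemma₁ y (y ^ r) r ⟩
  y * (y ^ r * (y + r)) + y * y ^ r         ≤⟨ +-mono-≤ (*-monoʳ-≤ y (bernoulli y r)) (*-monoʳ-≤ y (^-monoˡ-≤ r (n≤1+n y))) ⟩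
  y * (suc y ^ r * y) + y * suc y ^ r       ≡⟨ lemma₂ y (suc y ^ r) ⟩
  suc y * suc y ^ r * y                     ∎
  where
  open ≤-Reasoning
  lemma₁ : ∀ y s r → y * s * (y + suc r) ≡ y * (s * (y + r)) + y * s
  lemma₁ = solve-∀
  lemma₂ : ∀ y s → y * (s * y) + y * s ≡ suc y * s * y
  lemma₂ = solve-∀

-- If x ≥ y + 1, then (x / y)^r ≥ 1 + r / y by Bernoulli, and r = c y makes this c + 1.
power-trick : ∀ {x y} c → 0 < y → (∀ r → x ^ r ≤ c * y ^ r) → x ≤ y
power-trick {x} {y} c y>0 bound = ≮⇒≥ λ y<x → <-irrefl refl (begin-strict
  c * (y ^ r * y)        <⟨ m<n+m (c * (y ^ r * y)) (*-mono-< (m^n>0 y r) y>0) ⟩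
  y ^ r * y + c * (y ^ r * y) ≡⟨ lemma (y ^ r) y c ⟩
  y ^ r * (y + c * y)    ≤⟨ bernoulli y r ⟩
  suc y ^ r * y          ≤⟨ *-monoˡ-≤ y (^-monoˡ-≤ r y<x) ⟩
  x ^ r * y              ≤⟨ *-monoˡ-≤ y (bound r) ⟩
  c * y ^ r * y          ≡⟨ *-assoc c (y ^ r) y ⟩
  c * (y ^ r * y)        ∎)
  where
  open ≤-Reasoning
  instance _ = >-nonZero y>0
  r = c * y
  lemma : ∀ s y c → s * y + c * (s * y) ≡ s * (y + c * y)
  lemma = solve-∀

-- Since −2 = p − 2 = d₀, these are the three-term progressions modulo p = 2 + d₀.
Progression : ∀ d₀ {N n} → (Fin N → Vec ℕ n) → (i j k : Fin N) → Set
Progression d₀ T i j k = ∀ l → 2 + d₀ ∣ lookup (T i) l + lookup (T j) l + d₀ * lookup (T k) l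

ProgressionFree : ∀ d₀ {N n} → (Fin N → Vec ℕ n) → Set
ProgressionFree d₀ T = ∀ i j k → Progression d₀ T i j k → i ≡ j × j ≡ k

module _ (d₀ : ℕ) (pr : Prime (2 + d₀)) where
  open Rate d₀ using (d; A; B; B<A; B>0; count)

  private p = 2 + d₀

  progression-free-size : ∀ {N n} (T : Fin N → Vec ℕ n) → ProgressionFree d₀ T → N ≤ 3 * length (lowDegree d n)
  progression-free-size {N} {n} T free = subst (_≤ 3 * length (lowDegree d n)) (length-tabulate {n = N} id)
    (slice-rank d pr T T z diagonal off-diagonal (allFin N) (allFin⁺ N))
    where
    z : Fin N → Vec ℕ n
    z k = Vec.map (d₀ *_) (T k)
    diagonal : ∀ i → Vanish p (T i) (T i) (z i)
    diagonal i l = divides (lookup (T i) l) (begin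
      t + t + lookup (z i) l     ≡⟨ cong (t + t +_) (lookup-map l (d₀ *_) (T i)) ⟩
      t + t + d₀ * t             ≡⟨ lemma t d₀ ⟩
      t * (2 + d₀)               ∎)
      where
      open ≡-Reasoning
      t = lookup (T i) l
      lemma : ∀ t d → t + t + d * t ≡ t * (2 + d)
      lemma = solve-∀
    off-diagonal : ∀ i j k → Vanish p (T i) (T j) (z k) → i ≡ j × j ≡ k
    off-diagonal i j k van = free i j k λ l →
      subst (λ e → p ∣ lookup (T i) l + lookup (T j) l + e) (lookup-map l (d₀ *_) (T k)) (van l)

  -- The r-fold Cartesian power of the family: an index encodes an r-tuple of indices, and its
  -- vector is the concatenation of the r vectors.
  tensorPower : ∀ {N n} r → (Fin N → Vec ℕ n) → Fin (N ^ r) → Vec ℕ (r * n)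
  tensorPower {n = n} r T i = Vec.tabulate λ c → lookup (T (finToFun i (proj₁ (remQuot {r} n c)))) (proj₂ (remQuot {r} n c))

  tensorPower-progressionFree : ∀ {N n} r (T : Fin N → Vec ℕ n) → ProgressionFree d₀ T → ProgressionFree d₀ (tensorPower r T)
  tensorPower-progressionFree {N} {n} r T free i j k prog =
    ext (λ a → proj₁ (coordinates a)) , ext (λ a → proj₂ (coordinates a))
    where
    entry : ∀ i a b → lookup (tensorPower r T i) (combine a b) ≡ lookup (T (finToFun i a)) b
    entry i a b = trans (lookup∘tabulate _ (combine a b))
      (cong (λ c → lookup (T (finToFun i (proj₁ c))) (proj₂ c)) (remQuot-combine {r} {n} a b))
    coordinates : ∀ a → finToFun i a ≡ finToFun j a × finToFun j a ≡ finToFun k a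
    coordinates a = free _ _ _ λ b → subst (p ∣_)
      (cong₂ _+_ (cong₂ _+_ (entry i a b) (entry j a b)) (cong (d₀ *_) (entry k a b))) (prog (combine a b))
    funToFin-cong : ∀ {m n} {f g : Fin m → Fin n} → (∀ a → f a ≡ g a) → funToFin f ≡ funToFin g
    funToFin-cong {zero}  e = refl
    funToFin-cong {suc m} e = cong₂ combine (e zero) (funToFin-cong (e ∘ suc))
    ext : ∀ {i j : Fin (N ^ r)} → (∀ a → finToFun i a ≡ finToFun j a) → i ≡ j
    ext {i} {j} e = trans (sym (funToFin-finToFin {r} {N} i)) (trans (funToFin-cong e) (funToFin-finToFin {r} {N} j))

  -- Applying the slice rank bound to all tensor powers removes its factor 3.
  progression-free-bound : ∀ {N n} (T : Fin N → Vec ℕ n) → ProgressionFree d₀ T → N * B ^ n ≤ A ^ n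
  progression-free-bound {N} {n} T free = power-trick 3 (m^n>0 A {{>-nonZero (<-trans B>0 B<A)}} n) λ r → begin
    (N * B ^ n) ^ r                             ≡⟨ ^-distribʳ-* r N (B ^ n) ⟩
    N ^ r * (B ^ n) ^ r                         ≡⟨ cong (N ^ r *_) (exponent B r) ⟩
    N ^ r * B ^ (r * n)                         ≤⟨ *-monoˡ-≤ (B ^ (r * n)) (progression-free-size (tensorPower r T) (tensorPower-progressionFree r T free)) ⟩
    3 * length (lowDegree d (r * n)) * B ^ (r * n) ≡⟨ *-assoc 3 (length (lowDegree d (r * n))) (B ^ (r * n)) ⟩
    3 * (length (lowDegree d (r * n)) * B ^ (r * n)) ≤⟨ *-monoʳ-≤ 3 (count (r * n)) ⟩
    3 * A ^ (r * n)                             ≡⟨ cong (3 *_) (exponent A r) ⟨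
    3 * (A ^ n) ^ r                             ∎
    where
    open ≤-Reasoning
    exponent : ∀ x r → (x ^ n) ^ r ≡ x ^ (r * n)
    exponent x r = trans (^-*-assoc x n r) (cong (x ^_) (*-comm n r))

-- Existence of the Erdős–Ginzburg–Ziv constant

Searchable : Set → Set₁
Searchable A = ∀ {P : A → Set} → (∀ a → Dec (P a)) → (∀ a → P a) ⊎ ∃ λ a → ¬ P a

search-Fin : ∀ n → Searchable (Fin n)
search-Fin n P? with all? P?
... | yes ∀P = inj₁ ∀P
... | no  ¬∀ = inj₂ (¬∀⟶∃¬ n _ P? ¬∀)

search-Vec : ∀ {A} → Searchable A → ∀ n → Searchable (Vec A n)
search-Vec search zero P? with P? []
... | yes p = inj₁ λ { [] → p }
... | no ¬p = inj₂ ([] , ¬p)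
search-Vec {A} search (suc n) {P} P? with search {λ a → ∀ as → P (a ∷ as)} (λ a → heads a (search-Vec search n (λ as → P? (a ∷ as))))
  where
  heads : ∀ a → (∀ as → P (a ∷ as)) ⊎ (∃ λ as → ¬ P (a ∷ as)) → Dec (∀ as → P (a ∷ as))
  heads a (inj₁ ∀P)       = yes ∀P
  heads a (inj₂ (as , ¬p)) = no (λ ∀P → ¬p (∀P as))
... | inj₁ ∀P       = inj₁ λ { (a ∷ as) → ∀P a as }
... | inj₂ (a , ¬∀) with search-Vec search n (λ as → P? (a ∷ as))
...   | inj₁ ∀P       = contradiction ∀P ¬∀
...   | inj₂ (as , ¬p) = inj₂ (a ∷ as , ¬p)

sublist? : ∀ {A : Set} {P : List A → Set} → (∀ xs → Dec (P xs)) → ∀ xs → Dec (∃ λ ys → ys ⊆ xs × P ys)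
sublist? P? [] with P? []
... | yes p = yes ([] , [] , p)
... | no ¬p = no λ { ([] , [] , p) → ¬p p }
sublist? P? (x ∷ xs) with sublist? P? xs | sublist? (P? ∘ (x ∷_)) xs
... | yes (ys , ys⊆ , p) | _                  = yes (ys , x ∷ʳ ys⊆ , p)
... | no _               | yes (ys , ys⊆ , p) = yes (x ∷ ys , refl ∷ ys⊆ , p)
... | no ¬skip           | no ¬keep           = no λ
  { (ys , _ ∷ʳ ys⊆ , p)       → ¬skip (ys , ys⊆ , p)
  ; (_ ∷ ys , refl ∷ ys⊆ , p) → ¬keep (ys , ys⊆ , p) }

hasZeroSum? : ∀ {q n} ℓ (S : Seq q n) → Dec (HasZeroSumSubseqOfLength ℓ S)
hasZeroSum? {q} ℓ = sublist? (λ T → length T ≟ ℓ ×-dec all? (λ i → q ∣? _))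

HasZeroSum-⊆ : ∀ {q n ℓ} {S S′ : Seq q n} → S ⊆ S′ → HasZeroSumSubseqOfLength ℓ S → HasZeroSumSubseqOfLength ℓ S′
HasZeroSum-⊆ S⊆ (T , T⊆ , rest) = T , ⊆-trans T⊆ S⊆ , rest

prefix : ∀ {A : Set} ℓ (S : List A) → ℓ ≤ length S → ∃ λ (v : Vec A ℓ) → toList v ⊆ S
prefix zero    S       _         = [] , minimum S
prefix (suc ℓ) (x ∷ S) (s≤s ℓ≤) with v , v⊆ ← prefix ℓ S ℓ≤ = x ∷ v , refl ∷ v⊆

-- Sequences of length exactly ℓ decide the property, since longer ones contain a prefix of that
-- length; there are finitely many of them. The counterexample later serves as the extremal sequence
-- for Property D.
egz-or-counterexample : ∀ q n ℓ → EGZProperty q n ℓ ⊎ ∃ λ S → length S ≡ ℓ × ¬ HasZeroSumSubseqOfLength {q} {n} q S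
egz-or-counterexample q n ℓ with search-Vec (search-Vec (search-Fin q) n) ℓ (λ v → hasZeroSum? q (toList v))
... | inj₁ all        = inj₁ λ S ℓ≤ → let v , v⊆ = prefix ℓ S ℓ≤ in HasZeroSum-⊆ v⊆ (all v)
... | inj₂ (v , none) = inj₂ (toList v , length-toList v , none)

-- Descent from any valid length. The counterexample that stops it also refutes every shorter
-- length.
egz-constant : ∀ q n ℓ → EGZProperty q n ℓ → ∃ λ s → IsEGZConstant q n s × s ≤ ℓ
egz-constant q n zero    egz = 0 , (egz , λ _ _ → z≤n) , z≤n
egz-constant q n (suc ℓ) egz with egz-or-counterexample q n ℓ
... | inj₁ egz′ = let s , const , s≤ = egz-constant q n ℓ egz′ in s , const , m≤n⇒m≤1+n s≤
... | inj₂ (S , len , none) = suc ℓ , (egz , minimal) , ≤-refl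
  where
  minimal : ∀ ℓ′ → EGZProperty q n ℓ′ → suc ℓ ≤ ℓ′
  minimal ℓ′ egz′ = ≰⇒> λ ℓ′≤ℓ → none (egz′ S (subst (ℓ′ ≤_) (sym len) ℓ′≤ℓ))

-- An upper bound by pigeonhole

∑-all≡ : ∀ {A : Set} (f : A → ℕ) {v xs} → All (v ≡_) xs → ∑ f xs ≡ length xs * f v
∑-all≡ f []           = refl
∑-all≡ f (refl ∷ all) = cong (f _ +_) (∑-all≡ f all)

length-filter-¬ : ∀ {A : Set} {P : A → Set} (P? : ∀ a → Dec (P a)) xs →
  length (filter P? xs) + length (filter (¬? ∘ P?) xs) ≡ length xs
length-filter-¬ P? []       = refl
length-filter-¬ P? (x ∷ xs) with P? x
... | yes _ = cong suc (length-filter-¬ P? xs)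
... | no  _ = trans (+-suc (length (filter P? xs)) _) (cong suc (length-filter-¬ P? xs))

pigeonhole : ∀ {A : Set} (_≟ᴬ_ : (a b : A) → Dec (a ≡ b)) L (vals xs : List A) → All (_∈ vals) xs →
  length vals * L < length xs → ∃₂ λ v ys → ys ⊆ xs × L < length ys × All (v ≡_) ys
pigeonhole _≟ᴬ_ L [] (x ∷ xs) (() ∷ _) _
pigeonhole _≟ᴬ_ L (v ∷ vals) xs xs∈ len with L <? length (filter (v ≟ᴬ_) xs)
... | yes many = v , filter (v ≟ᴬ_) xs , filter-⊆ (v ≟ᴬ_) xs , many , All.all-filter (v ≟ᴬ_) xs
... | no  few  =
  let w , ys , ys⊆ , rest = pigeonhole _≟ᴬ_ L vals others
        (All.zipWith (λ (x∈ , v≢x) → tail v≢x x∈) (All.filter⁺ v≢? xs∈ , All.all-filter v≢? xs)) enough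
  in w , ys , ⊆-trans ys⊆ (filter-⊆ v≢? xs) , rest
  where
  v≢? = λ x → ¬? (v ≟ᴬ x)
  others = filter v≢? xs
  tail : ∀ {x} → ¬ v ≡ x → x ∈ v ∷ vals → x ∈ vals
  tail v≢x (here refl) = contradiction refl v≢x
  tail v≢x (there x∈)  = x∈
  enough : length vals * L < length others
  enough = +-cancelˡ-< L _ _ (begin-strict
    L + length vals * L                                    <⟨ len ⟩
    length xs                                              ≡⟨ length-filter-¬ (v ≟ᴬ_) xs ⟨
    length (filter (v ≟ᴬ_) xs) + length others             ≤⟨ +-monoˡ-≤ (length others) (≮⇒≥ few) ⟩
    L + length others                                      ∎)
    where open ≤-Reasoning

∑-1 : ∀ {A : Set} (xs : List A) → ∑ (λ _ → 1) xs ≡ length xs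
∑-1 xs = trans (∑-const 1 xs) (*-identityʳ (length xs))

length-vecs : ∀ {A : Set} (L : List A) n → length (vecs L n) ≡ length L ^ n
length-vecs L n = begin
  length (vecs L n)                 ≡⟨ ∑-1 (vecs L n) ⟨
  ∑ (λ _ → 1) (vecs L n)            ≡⟨ ∑-cong ∏-1 (vecs L n) ⟨
  ∑ (∏ (λ _ → 1)) (vecs L n)        ≡⟨ ∑-vecs (λ _ → 1) L n ⟩
  ∑ (λ _ → 1) L ^ n                 ≡⟨ cong (_^ n) (∑-1 L) ⟩
  length L ^ n                      ∎
  where
  open ≡-Reasoning
  ∏-1 : ∀ {A : Set} {n} (v : Vec A n) → ∏ (λ _ → 1) v ≡ 1
  ∏-1 []      = refl
  ∏-1 (x ∷ v) = trans (*-identityˡ _) (∏-1 v)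

-- Some value occurs q = d + 1 times, and q equal terms sum to zero. This starts the descent to the
-- constant; for q = 2 it is the bound 2ⁿ + 1 on which the powers of 2 rest.
egz-pigeonhole : ∀ d n → EGZProperty (suc d) n (suc (suc d ^ n * d))
egz-pigeonhole d n S len = repeated (pigeonhole (≡-dec _≟ᶠ_) d (vecs (allFin (suc d)) n) S
    (All.tabulate (λ _ → ∈-vecs (VecAll.universal ∈-allFin _)))
    (subst (λ N → N * d < length S) (sym (trans (length-vecs (allFin (suc d)) n) (cong (_^ n) (length-tabulate {n = suc d} id)))) len))
  where
  repeated : (∃₂ λ v ys → ys ⊆ S × d < length ys × All (v ≡_) ys) → HasZeroSumSubseqOfLength (suc d) S
  repeated (v , ys , ys⊆ , d< , all) = take (suc d) ys , ⊆-trans (take-⊆ (suc d) ys) ys⊆ , len′ ,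
    λ i → subst (suc d ∣_) (sym (∑-all≡ (λ w → toℕ (lookup w i)) (All.take⁺ (suc d) all)))
      (subst (λ N → suc d ∣ N * toℕ (lookup v i)) (sym len′) (m∣m*n (toℕ (lookup v i))))
    where
    len′ : length (take (suc d) ys) ≡ suc d
    len′ = trans (length-take (suc d) ys) (m≤n⇒m⊓n≡m d<)

-- Products of moduli

⊆⇒↭++ : ∀ {A : Set} {xs ys : List A} → xs ⊆ ys → ∃ λ zs → ys ↭ xs ++ zs
⊆⇒↭++ []            = [] , ↭-refl
⊆⇒↭++ {xs = xs} (y ∷ʳ xs⊆) with zs , eq ← ⊆⇒↭++ xs⊆ = y ∷ zs , ↭-trans (prep y eq) (↭-sym (shift y xs zs))
⊆⇒↭++ (refl ∷ xs⊆)  with zs , eq ← ⊆⇒↭++ xs⊆ = zs , prep _ eq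

⊆-resp-↭ : ∀ {A : Set} {ts xs ys : List A} → xs ↭ ys → ts ⊆ xs → ∃ λ ts′ → ts′ ⊆ ys × ts ↭ ts′
⊆-resp-↭ refl        ts⊆             = _ , ts⊆ , ↭-refl
⊆-resp-↭ (prep x eq) (_ ∷ʳ ts⊆)      with us , us⊆ , eq′ ← ⊆-resp-↭ eq ts⊆ = us , x ∷ʳ us⊆ , eq′
⊆-resp-↭ (prep x eq) (refl ∷ ts⊆)    with us , us⊆ , eq′ ← ⊆-resp-↭ eq ts⊆ = x ∷ us , refl ∷ us⊆ , prep x eq′
⊆-resp-↭ (swap x y eq) (_ ∷ʳ _ ∷ʳ ts⊆)     with us , us⊆ , eq′ ← ⊆-resp-↭ eq ts⊆ = us , y ∷ʳ x ∷ʳ us⊆ , eq′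
⊆-resp-↭ (swap x y eq) (_ ∷ʳ refl ∷ ts⊆)   with us , us⊆ , eq′ ← ⊆-resp-↭ eq ts⊆ = y ∷ us , refl ∷ x ∷ʳ us⊆ , prep y eq′
⊆-resp-↭ (swap x y eq) (refl ∷ _ ∷ʳ ts⊆)   with us , us⊆ , eq′ ← ⊆-resp-↭ eq ts⊆ = x ∷ us , y ∷ʳ refl ∷ us⊆ , prep x eq′
⊆-resp-↭ (swap x y eq) (refl ∷ refl ∷ ts⊆) with us , us⊆ , eq′ ← ⊆-resp-↭ eq ts⊆ = y ∷ x ∷ us , refl ∷ refl ∷ us⊆ , swap x y eq′
⊆-resp-↭ (↭-transitive eq₁ eq₂) ts⊆ with us , us⊆ , eq₁′ ← ⊆-resp-↭ eq₁ ts⊆ with vs , vs⊆ , eq₂′ ← ⊆-resp-↭ eq₂ us⊆ =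
  vs , vs⊆ , ↭-trans eq₁′ eq₂′

⊆-map⁻ : ∀ {A B : Set} (g : A → B) {ts} xs → ts ⊆ map g xs → ∃ λ us → us ⊆ xs × ts ≡ map g us
⊆-map⁻ g []       []           = [] , [] , refl
⊆-map⁻ g (x ∷ xs) (_ ∷ʳ ts⊆)   with us , us⊆ , eq ← ⊆-map⁻ g xs ts⊆ = us , x ∷ʳ us⊆ , eq
⊆-map⁻ g (x ∷ xs) (refl ∷ ts⊆) with us , us⊆ , eq ← ⊆-map⁻ g xs ts⊆ = x ∷ us , refl ∷ us⊆ , cong (g x ∷_) eq

concatMap-↭ : ∀ {A B : Set} (g : A → List B) {xs ys} → xs ↭ ys → concatMap g xs ↭ concatMap g ys
concatMap-↭ g refl          = ↭-refl
concatMap-↭ g (prep x eq)   = ++⁺ˡ (g x) (concatMap-↭ g eq)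
concatMap-↭ g (swap x y eq) = ↭-trans (shifts (g x) (g y)) (++⁺ˡ (g y) (++⁺ˡ (g x) (concatMap-↭ g eq)))
concatMap-↭ g (↭-transitive e e′)  = ↭-trans (concatMap-↭ g e) (concatMap-↭ g e′)

-- The EGZ property for sequences whose terms carry labels in an arbitrary type: in the
-- proof of egz-* it is applied to a sequence of blocks of terms.
LabelledEGZ : ℕ → ℕ → ℕ → Set₁
LabelledEGZ q n ℓ = ∀ {A : Set} (f : A → Fin n → ℕ) (S : List A) → ℓ ≤ length S →
  ∃₂ λ T R → S ↭ T ++ R × length T ≡ q × (∀ i → q ∣ ∑ (λ a → f a i) T)

∑-% : ∀ {A : Set} q .{{_ : NonZero q}} (f : A → ℕ) xs → q ∣ ∑ (λ a → f a % q) xs → q ∣ ∑ f xs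
∑-% q f xs q∣ = subst (q ∣_) (sym (begin
  ∑ f xs                                              ≡⟨ ∑-cong (λ a → trans (m≡m%n+[m/n]*n (f a) q) (cong (f a % q +_) (*-comm (f a / q) q))) xs ⟩
  ∑ (λ a → f a % q + q * (f a / q)) xs                ≡⟨ ∑-+ _ _ xs ⟩
  ∑ (λ a → f a % q) xs + ∑ (λ a → q * (f a / q)) xs   ≡⟨ cong (∑ (λ a → f a % q) xs +_) (∑-*ˡ q _ xs) ⟩
  ∑ (λ a → f a % q) xs + q * ∑ (λ a → f a / q) xs     ∎))
  (∣m∣n⇒∣m+n q∣ (m∣m*n _))
  where open ≡-Reasoning

egz⇒labelled : ∀ {q n ℓ} .{{_ : NonZero q}} → EGZProperty q n ℓ → LabelledEGZ q n ℓ
egz⇒labelled {q} {n} {ℓ} egz {A} f S len with egz (map reduce S) (subst (ℓ ≤_) (sym (length-map reduce S)) len)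
  where
  reduce : A → Elem q n
  reduce a = Vec.tabulate λ i → f a i mod q
... | T , T⊆ , T-len , zero-sum with us , us⊆ , refl ← ⊆-map⁻ _ S T⊆ with R , eq ← ⊆⇒↭++ us⊆ =
  us , R , eq , trans (sym (length-map _ us)) T-len , λ i → ∑-% q (λ a → f a i) us
    (subst (q ∣_) (trans (∑-map _ _ us) (∑-cong (λ a → trans (cong toℕ (lookup∘tabulate _ i)) (toℕ-fromℕ< (m%n<n (f a i) q))) us)) (zero-sum i))

labelled⇒egz : ∀ {q n ℓ} → LabelledEGZ q n ℓ → EGZProperty q n ℓ
labelled⇒egz {q} egz S len with T , R , eq , T-len , zero-sum ← egz (λ v i → toℕ (lookup v i)) S len
  with T′ , T′⊆ , T↭T′ ← ⊆-resp-↭ (↭-sym eq) (Sublist.++⁺ʳ R ⊆-refl) =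
  T′ , T′⊆ , trans (sym (↭-length T↭T′)) T-len , λ i → subst (q ∣_) (∑-↭ _ T↭T′) (zero-sum i)

module _ {a b n x y : ℕ} (egzᵃ : LabelledEGZ a n (suc x)) (egzᵇ : LabelledEGZ b n (suc y)) {A : Set} (f : A → Fin n → ℕ) where

  Block : Set
  Block = Σ (List A) λ B → length B ≡ b × (∀ i → b ∣ ∑ (λ a → f a i) B)

  -- The block sum divided by b, as the label for the second round: averages summing to a multiple
  -- of a mean terms summing to a multiple of a b.
  average : Block → Fin n → ℕ
  average (_ , _ , b∣) i = quotient (b∣ i)

  -- The first j blocks use up j b terms, and y + 1 terms must remain for the last one.
  extract : ∀ j S → suc (j * b + y) ≤ length S → ∃₂ λ (Bs : List Block) R → length Bs ≡ suc j × S ↭ concatMap proj₁ Bs ++ R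
  extract j S len with egzᵇ f S (≤-trans (s≤s (m≤n+m y (j * b))) len)
  extract zero    S len | B , R , eq , B-len , b∣ = (B , B-len , b∣) ∷ [] , R , refl , ↭-trans eq (↭-reflexive (sym (++-assoc B [] R)))
  extract (suc j) S len | B , R , eq , B-len , b∣ with extract j R (+-cancelˡ-≤ b _ _ (begin
    b + suc (j * b + y)       ≡⟨ lemma b (j * b) y ⟩
    suc (b + j * b + y)       ≤⟨ len ⟩
    length S                  ≡⟨ ↭-length eq ⟩
    length (B ++ R)           ≡⟨ length-++ B ⟩
    length B + length R       ≡⟨ cong (_+ length R) B-len ⟩
    b + length R              ∎))
    where
    open ≤-Reasoning
    lemma : ∀ b c y → b + suc (c + y) ≡ suc (b + c + y)
    lemma = solve-∀
  ... | Bs , R′ , Bs-len , eq′ = (B , B-len , b∣) ∷ Bs , R′ , cong suc Bs-len ,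
    ↭-trans eq (↭-trans (++⁺ˡ B eq′) (↭-reflexive (sym (++-assoc B (concatMap proj₁ Bs) R′))))

  length-blocks : ∀ (Bs : List Block) → length (concatMap proj₁ Bs) ≡ length Bs * b
  length-blocks []                 = refl
  length-blocks ((B , len , _) ∷ Bs) = trans (length-++ B) (cong₂ _+_ len (length-blocks Bs))

  ∑-blocks : ∀ i (Bs : List Block) → ∑ (λ a → f a i) (concatMap proj₁ Bs) ≡ ∑ (λ B → average B i) Bs * b
  ∑-blocks i []                       = refl
  ∑-blocks i (blk@(B , _ , b∣) ∷ Bs) = begin
    ∑ (λ a → f a i) (B ++ concatMap proj₁ Bs)                ≡⟨ ∑-++ (λ a → f a i) B (concatMap proj₁ Bs) ⟩
    ∑ (λ a → f a i) B + ∑ (λ a → f a i) (concatMap proj₁ Bs) ≡⟨ cong₂ _+_ (_∣_.equality (b∣ i)) (∑-blocks i Bs) ⟩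
    average blk i * b + ∑ (λ B → average B i) Bs * b         ≡⟨ *-distribʳ-+ b (average blk i) _ ⟨
    (average blk i + ∑ (λ B → average B i) Bs) * b           ∎
    where open ≡-Reasoning

  -- Two rounds: x + 1 blocks with sum zero modulo b are extracted, and among them a blocks whose
  -- averages have sum zero modulo a are selected.
  labelled-* : ∀ S → suc (x * b + y) ≤ length S →
    ∃₂ λ T R → S ↭ T ++ R × length T ≡ a * b × (∀ i → a * b ∣ ∑ (λ a → f a i) T)
  labelled-* S len with Bs , R , Bs-len , eq ← extract x S len
    with Ts , Rs , eq′ , Ts-len , a∣ ← egzᵃ average Bs (≤-reflexive (sym Bs-len)) =
    concatMap proj₁ Ts , concatMap proj₁ Rs ++ R ,
    ↭-trans eq (↭-trans (++⁺ʳ R (↭-trans (concatMap-↭ proj₁ eq′) (↭-reflexive (concatMap-++ proj₁ Ts Rs))))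
      (↭-reflexive (++-assoc (concatMap proj₁ Ts) (concatMap proj₁ Rs) R))) ,
    trans (length-blocks Ts) (cong (_* b) Ts-len) ,
    λ i → subst (a * b ∣_) (sym (∑-blocks i Ts)) (*-monoˡ-∣ b (a∣ i))

egz-* : ∀ {a b n x y} .{{_ : NonZero a}} .{{_ : NonZero b}} →
  EGZProperty a n (suc x) → EGZProperty b n (suc y) → EGZProperty (a * b) n (suc (x * b + y))
egz-* egzᵃ egzᵇ = labelled⇒egz (labelled-* (egz⇒labelled egzᵃ) (egz⇒labelled egzᵇ))

-- Property D

δ : ∀ {N} → Fin N → Fin N → ℕ
δ i t = if does (i ≟ᶠ t) then 1 else 0

-- Multiplicity functions add up, so T_i + T_j + (p - 2) T_k is handled without regard to the order
-- or coincidences of the three indices.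
multi : ∀ {A : Set} (T : List A) → (Fin (length T) → ℕ) → List A
multi []      m = []
multi (x ∷ T) m = replicate (m zero) x ++ multi T (m ∘ suc)

replicate-⊆ : ∀ {A : Set} (x : A) {m n} → m ≤ n → replicate m x ⊆ replicate n x
replicate-⊆ x z≤n       = minimum _
replicate-⊆ x (s≤s m≤n) = refl ∷ replicate-⊆ x m≤n

multi-⊆ : ∀ {A : Set} (T : List A) {m c} → (∀ t → m t ≤ c) → multi T m ⊆ rep T c
multi-⊆ []      m≤c = []
multi-⊆ (x ∷ T) m≤c = Sublist.++⁺ (replicate-⊆ x (m≤c zero)) (multi-⊆ T (m≤c ∘ suc))

length-rep : ∀ {A : Set} (T : List A) c → length (rep T c) ≡ length T * c
length-rep []      c = refl
length-rep (x ∷ T) c = trans (length-++ (replicate c x)) (cong₂ _+_ (length-replicate c) (length-rep T c))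

module _ {A : Set} (f : A → ℕ) where

  ∑-replicate : ∀ c x → ∑ f (replicate c x) ≡ c * f x
  ∑-replicate zero    x = refl
  ∑-replicate (suc c) x = cong (f x +_) (∑-replicate c x)

  ∑-multi-∷ : ∀ x T m → ∑ f (multi (x ∷ T) m) ≡ m zero * f x + ∑ f (multi T (m ∘ suc))
  ∑-multi-∷ x T m = trans (∑-++ f (replicate (m zero) x) _) (cong (_+ _) (∑-replicate (m zero) x))

  ∑-multi-0 : ∀ T → ∑ f (multi T (λ _ → 0)) ≡ 0
  ∑-multi-0 []      = refl
  ∑-multi-0 (x ∷ T) = ∑-multi-0 T

  ∑-multi-δ : ∀ T i → ∑ f (multi T (δ i)) ≡ f (List.lookup T i)
  ∑-multi-δ (x ∷ T) zero    = trans (cong (f x +_) (∑-multi-0 T)) (+-identityʳ (f x))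
  ∑-multi-δ (x ∷ T) (suc i) = ∑-multi-δ T i

  ∑-multi-+ : ∀ T m m′ → ∑ f (multi T (λ t → m t + m′ t)) ≡ ∑ f (multi T m) + ∑ f (multi T m′)
  ∑-multi-+ []      m m′ = refl
  ∑-multi-+ (x ∷ T) m m′ = begin
    ∑ f (multi (x ∷ T) (λ t → m t + m′ t))                   ≡⟨ ∑-multi-∷ x T (λ t → m t + m′ t) ⟩
    (m zero + m′ zero) * f x + ∑ f (multi T (λ t → m (suc t) + m′ (suc t))) ≡⟨ cong ((m zero + m′ zero) * f x +_) (∑-multi-+ T _ _) ⟩
    (m zero + m′ zero) * f x + (M + M′)                      ≡⟨ lemma (m zero) (m′ zero) (f x) M M′ ⟩
    (m zero * f x + M) + (m′ zero * f x + M′)                ≡⟨ cong₂ _+_ (∑-multi-∷ x T m) (∑-multi-∷ x T m′) ⟨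
    ∑ f (multi (x ∷ T) m) + ∑ f (multi (x ∷ T) m′)           ∎
    where
    open ≡-Reasoning
    M = ∑ f (multi T (m ∘ suc))
    M′ = ∑ f (multi T (m′ ∘ suc))
    lemma : ∀ a b x c d → (a + b) * x + (c + d) ≡ (a * x + c) + (b * x + d)
    lemma = solve-∀

  ∑-multi-* : ∀ T c m → ∑ f (multi T (λ t → c * m t)) ≡ c * ∑ f (multi T m)
  ∑-multi-* []      c m = sym (*-zeroʳ c)
  ∑-multi-* (x ∷ T) c m = begin
    ∑ f (multi (x ∷ T) (λ t → c * m t))                           ≡⟨ ∑-multi-∷ x T (λ t → c * m t) ⟩
    c * m zero * f x + ∑ f (multi T (λ t → c * m (suc t)))        ≡⟨ cong₂ _+_ (*-assoc c (m zero) (f x)) (∑-multi-* T c _) ⟩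
    c * (m zero * f x) + c * ∑ f (multi T (m ∘ suc))              ≡⟨ *-distribˡ-+ c (m zero * f x) _ ⟨
    c * (m zero * f x + ∑ f (multi T (m ∘ suc)))                  ≡⟨ cong (c *_) (∑-multi-∷ x T m) ⟨
    c * ∑ f (multi (x ∷ T) m)                                     ∎
    where open ≡-Reasoning

module Embedding (d₀ : ℕ) (1≤d₀ : 1 ≤ d₀) {n : ℕ} (T : Seq (2 + d₀) n) (i j k : Fin (length T))
  (prog : Progression d₀ (λ i → Vec.map toℕ (List.lookup T i)) i j k) where

  m : Fin (length T) → ℕ
  m t = δ i t + δ j t + d₀ * δ k t

  ∑-m : ∀ f → ∑ f (multi T m) ≡ f (List.lookup T i) + f (List.lookup T j) + d₀ * f (List.lookup T k)
  ∑-m f = begin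
    ∑ f (multi T m)                                                                    ≡⟨ ∑-multi-+ f T _ _ ⟩
    ∑ f (multi T (λ t → δ i t + δ j t)) + ∑ f (multi T (λ t → d₀ * δ k t))             ≡⟨ cong₂ _+_ (∑-multi-+ f T _ _) (∑-multi-* f T d₀ _) ⟩
    ∑ f (multi T (δ i)) + ∑ f (multi T (δ j)) + d₀ * ∑ f (multi T (δ k))               ≡⟨ cong₂ _+_ (cong₂ _+_ (∑-multi-δ f T i) (∑-multi-δ f T j)) (cong (d₀ *_) (∑-multi-δ f T k)) ⟩
    f (List.lookup T i) + f (List.lookup T j) + d₀ * f (List.lookup T k)               ∎
    where open ≡-Reasoning

  d₀*δ≤d₀ : ∀ {P : Set} (P? : Dec P) → d₀ * (if does P? then 1 else 0) ≤ d₀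
  d₀*δ≤d₀ (yes _) = ≤-reflexive (*-identityʳ d₀)
  d₀*δ≤d₀ (no  _) = ≤-trans (≤-reflexive (*-zeroʳ d₀)) z≤n

  m≤ : (∀ t → i ≡ t → j ≡ t → ¬ k ≡ t) → ∀ t → m t ≤ suc d₀
  m≤ distinct t with i ≟ᶠ t | j ≟ᶠ t | k ≟ᶠ t
  ... | yes i≡t | yes j≡t | yes k≡t = contradiction k≡t (distinct t i≡t j≡t)
  -- Multiplicity 2 ≤ p - 1: here p is odd.
  ... | yes _   | yes _   | no  _   = subst (λ z → 2 + z ≤ suc d₀) (sym (*-zeroʳ d₀)) (s≤s 1≤d₀)
  ... | yes _   | no  _   | k≟t     = s≤s (d₀*δ≤d₀ k≟t)
  ... | no  _   | yes _   | k≟t     = s≤s (d₀*δ≤d₀ k≟t)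
  ... | no  _   | no  _   | k≟t     = m≤n⇒m≤1+n (d₀*δ≤d₀ k≟t)

  embed : (∀ t → i ≡ t → j ≡ t → ¬ k ≡ t) → HasZeroSumSubseqOfLength (2 + d₀) (rep T (suc d₀))
  embed distinct = multi T m , multi-⊆ T (m≤ distinct) ,
    trans (sym (∑-1 (multi T m))) (trans (∑-m (λ _ → 1)) (cong (2 +_) (*-identityʳ d₀))) ,
    λ l → subst (2 + d₀ ∣_) (sym (trans (∑-m (λ v → toℕ (lookup v l)))
      (sym (cong₂ _+_ (cong₂ _+_ (lookup-map l toℕ (List.lookup T i)) (lookup-map l toℕ (List.lookup T j)))
                      (cong (d₀ *_) (lookup-map l toℕ (List.lookup T k))))))) (prog l)

-- Unless i = j = k, the terms T_i, T_j and p ∸ 2 copies of T_k form a subsequence of T^(p ∸ 1).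
rep-progressionFree : ∀ d₀ → 1 ≤ d₀ → ∀ {n} (T : Seq (2 + d₀) n) →
  ¬ HasZeroSumSubseqOfLength (2 + d₀) (rep T (suc d₀)) → ProgressionFree d₀ (λ i → Vec.map toℕ (List.lookup T i))
rep-progressionFree d₀ 1≤d₀ {n} T none i j k prog with i ≟ᶠ j | j ≟ᶠ k
... | yes i≡j | yes j≡k = i≡j , j≡k
... | yes _   | no  j≢k = contradiction (embed (λ t _ j≡t k≡t → j≢k (trans j≡t (sym k≡t)))) none
  where open Embedding d₀ 1≤d₀ T i j k prog
... | no  i≢j | _       = contradiction (embed (λ t i≡t j≡t _ → i≢j (trans i≡t (sym j≡t)))) none
  where open Embedding d₀ 1≤d₀ T i j k prog

property-D-bound : ∀ d₀ (pr : Prime (2 + d₀)) → 1 ≤ d₀ → ∀ n → PropertyD (2 + d₀) n →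
  ∃ λ e → EGZProperty (2 + d₀) n (suc e) × e * Rate.B d₀ ^ n ≤ Rate.A d₀ ^ n * suc d₀
property-D-bound d₀ pr 1≤d₀ n propertyD with egz-constant (2 + d₀) n _ (egz-pigeonhole (suc d₀) n)
-- The constant is not 0: the empty sequence has no subsequence of length p.
... | zero , (egz , _) , _ with ([] , [] , () , _) ← egz [] z≤n
... | suc e , const@(egz , minimal) , _ with egz-or-counterexample (2 + d₀) n e
-- Minimality of e + 1 forces a sequence of length exactly e without a zero-sum subsequence of
-- length p, as Property D requires.
...   | inj₁ egz′ = contradiction (minimal e egz′) (<-irrefl refl)
...   | inj₂ (S , len , none) with T , S↭ ← propertyD (suc e) const S len none = e , egz , (begin
  e * B ^ n                    ≡⟨ cong (_* B ^ n) (trans (sym len) (trans (↭-length S↭) (length-rep T (suc d₀)))) ⟩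
  length T * suc d₀ * B ^ n    ≡⟨ lemma (length T) (suc d₀) (B ^ n) ⟩
  length T * B ^ n * suc d₀    ≤⟨ *-monoˡ-≤ (suc d₀) (progression-free-bound d₀ pr (λ i → Vec.map toℕ (List.lookup T i)) (rep-progressionFree d₀ 1≤d₀ T
                                    λ (U , U⊆ , U-len , zero-sum) → let U′ , U′⊆ , U↭ = ⊆-resp-↭ (↭-sym S↭) U⊆ in
                                      none (U′ , U′⊆ , trans (sym (↭-length U↭)) U-len , λ l → subst (2 + d₀ ∣_) (∑-↭ _ U↭) (zero-sum l)))) ⟩
  A ^ n * suc d₀               ∎)
  where
  open ≤-Reasoning
  open Rate d₀ using (A; B)
  lemma : ∀ a b c → a * b * c ≡ a * c * b
  lemma = solve-∀

-- Composite moduli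

-- For e = s - 1 the bound e ≤ (A / B)ⁿ (q - 1). The factor q - 1 makes it stable under products at
-- a common rate, because (a - 1) b + (b - 1) = a b - 1.
Bounded : ℕ → ℕ → ℕ → Set
Bounded q A B = ∀ n → 1 ≤ n → ∃ λ e → EGZProperty q n (suc e) × e * B ^ n ≤ A ^ n * (q ∸ 1)

-- The rate c(q) of the theorem is the fraction A / B.
Rated : ℕ → Set
Rated q = ∃₂ λ A B → 0 < B × B < A × A < q * B × Bounded q A B

rated-prime : ∀ p → Prime p → 3 ≤ p → (∀ n → 1 ≤ n → PropertyD p n) → Rated p
rated-prime (suc (suc d₀)) pr (s≤s (s≤s 1≤d₀)) propertyD =
  A , B , B>0 , B<A , A<pB , λ n 1≤n → property-D-bound d₀ pr 1≤d₀ n (propertyD n 1≤n)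
  where open Rate d₀

bounded-mono : ∀ {q A B A′ B′} → 0 < B → A * B′ ≤ A′ * B → Bounded q A B → Bounded q A′ B′
bounded-mono {q} {A} {B} {A′} {B′} B>0 A/B≤A′/B′ bounded n 1≤n with e , egz , e≤ ← bounded n 1≤n =
  e , egz , *-cancelʳ-≤ _ _ (B ^ n) {{m^n≢0 B n {{>-nonZero B>0}}}} (begin
    e * B′ ^ n * B ^ n              ≡⟨ lemma e (B′ ^ n) (B ^ n) ⟩
    e * B ^ n * B′ ^ n              ≤⟨ *-monoˡ-≤ (B′ ^ n) e≤ ⟩
    A ^ n * (q ∸ 1) * B′ ^ n        ≡⟨ lemma (A ^ n) (q ∸ 1) (B′ ^ n) ⟩
    A ^ n * B′ ^ n * (q ∸ 1)        ≡⟨ cong (_* (q ∸ 1)) (^-distribʳ-* n A B′) ⟨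
    (A * B′) ^ n * (q ∸ 1)          ≤⟨ *-monoˡ-≤ (q ∸ 1) (^-monoˡ-≤ n A/B≤A′/B′) ⟩
    (A′ * B) ^ n * (q ∸ 1)          ≡⟨ cong (_* (q ∸ 1)) (^-distribʳ-* n A′ B) ⟩
    A′ ^ n * B ^ n * (q ∸ 1)        ≡⟨ lemma (A′ ^ n) (B ^ n) (q ∸ 1) ⟩
    A′ ^ n * (q ∸ 1) * B ^ n        ∎)
  where
  open ≤-Reasoning
  lemma : ∀ a b c → a * b * c ≡ a * c * b
  lemma = solve-∀

bounded-* : ∀ {a b A B} .{{_ : NonZero a}} .{{_ : NonZero b}} → Bounded a A B → Bounded b A B → Bounded (a * b) A B
bounded-* {a@(suc a′)} {b@(suc b′)} {A} {B} boundedᵃ boundedᵇ n 1≤n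
  with x , egzᵃ , x≤ ← boundedᵃ n 1≤n | y , egzᵇ , y≤ ← boundedᵇ n 1≤n =
  x * b + y , egz-* egzᵃ egzᵇ , (begin
    (x * b + y) * B ^ n                  ≡⟨ lemma₁ x b y (B ^ n) ⟩
    x * B ^ n * b + y * B ^ n            ≤⟨ +-mono-≤ (*-monoˡ-≤ b x≤) y≤ ⟩
    A ^ n * a′ * b + A ^ n * b′          ≡⟨ lemma₂ (A ^ n) a′ b′ ⟩
    A ^ n * (b′ + a′ * suc b′)           ∎)
  where
  open ≤-Reasoning
  lemma₁ : ∀ x b y e → (x * b + y) * e ≡ x * e * b + y * e
  lemma₁ = solve-∀
  lemma₂ : ∀ e a b → e * a * suc b + e * b ≡ e * (b + a * suc b)
  lemma₂ = solve-∀

rated-nonZero : ∀ {q} → Rated q → NonZero q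
rated-nonZero {suc q} _                             = _
rated-nonZero {zero}  (_ , _ , _ , _ , () , _)

rated-* : ∀ {a b} → Rated a → Rated b → Rated (a * b)
rated-* {a} {b} ra@(A , B , B>0 , B<A , A<aB , boundedᵃ) rb@(A′ , B′ , B′>0 , B′<A′ , A′<bB′ , boundedᵇ) =
  larger (≤-total (A * B′) (A′ * B))
  where
  instance
    a≢0 : NonZero a
    a≢0 = rated-nonZero ra
    b≢0 : NonZero b
    b≢0 = rated-nonZero rb
  larger : A * B′ ≤ A′ * B ⊎ A′ * B ≤ A * B′ → Rated (a * b)
  larger (inj₁ smaller) = A′ , B′ , B′>0 , B′<A′ , <-≤-trans A′<bB′ (*-monoˡ-≤ B′ (m≤n*m b a)) ,
    bounded-* (bounded-mono B>0 smaller boundedᵃ) boundedᵇ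
  larger (inj₂ bigger) = A , B , B>0 , B<A , <-≤-trans A<aB (*-monoˡ-≤ B (m≤m*n a b)) ,
    bounded-* boundedᵃ (bounded-mono B′>0 bigger boundedᵇ)

-- The list is non-empty because 1 is not rated: its rate would lie strictly between 1 and 1.
rated-product : ∀ {q qs} → All Rated (q ∷ qs) → Rated (product (q ∷ qs))
rated-product {q} (r ∷ [])         = subst Rated (sym (*-identityʳ q)) r
rated-product     (r ∷ all@(_ ∷ _)) = rated-* r (rated-product all)

rated-factors : ∀ k → 1 < k → (∀ p → Prime p → p ∣ k → Rated p) → Rated k
rated-factors k@(suc _) 1<k rated with factorise k
... | record { factors = []     ; isFactorisation = k≡1 } = contradiction (sym k≡1) (<⇒≢ 1<k)
... | record { factors = p ∷ ps ; isFactorisation = k≡  ; factorsPrime = primes } =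
  subst Rated (sym k≡) (rated-product (All.tabulate (λ {q} q∈ →
    rated q (All.lookup primes q∈) (subst (q ∣_) (sym k≡) (∈⇒∣product q∈)))))

-- With e(2) ≤ 2ⁿ each doubling adds 2ⁿ 2^a, a geometric sum.
egz-2^ : ∀ a n → EGZProperty (2 ^ a) n (suc (2 ^ n * (2 ^ a ∸ 1)))
egz-2^ zero    n = subst (EGZProperty 1 n ∘ suc) (trans (*-zeroʳ (1 ^ n)) (sym (*-zeroʳ (2 ^ n)))) (egz-pigeonhole 0 n)
egz-2^ (suc a) n = subst (EGZProperty (2 ^ suc a) n ∘ suc) (lengths (2 ^ a) (m^n>0 2 a))
  (egz-* {{_}} {{m^n≢0 2 a}} (egz-pigeonhole 1 n) (egz-2^ a n))
  where
  lengths : ∀ m → 0 < m → 2 ^ n * 1 * m + 2 ^ n * (m ∸ 1) ≡ 2 ^ n * (2 * m ∸ 1)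
  lengths (suc m) _ = lemma (2 ^ n) m
    where
    lemma : ∀ e m → e * 1 * suc m + e * m ≡ e * (m + (suc m + 0))
    lemma = solve-∀

-- Rational arithmetic

-- `Q._/_` normalises its fraction, which does not compute on variables; identities and inequalities
-- are checked on unnormalised fractions and carried over.
fromℚᵘ-homo-* : ∀ x y → Q.fromℚᵘ (x ℚᵘ.* y) ≡ Q.fromℚᵘ x Q.* Q.fromℚᵘ y
fromℚᵘ-homo-* x y = Q.toℚᵘ-injective (begin
  Q.toℚᵘ (Q.fromℚᵘ (x ℚᵘ.* y))                         ≈⟨ Q.toℚᵘ-fromℚᵘ (x ℚᵘ.* y) ⟩
  x ℚᵘ.* y                                             ≈⟨ ℚᵘ.*-cong (Q.toℚᵘ-fromℚᵘ x) (Q.toℚᵘ-fromℚᵘ y) ⟨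
  Q.toℚᵘ (Q.fromℚᵘ x) ℚᵘ.* Q.toℚᵘ (Q.fromℚᵘ y)         ≈⟨ Q.toℚᵘ-homo-* (Q.fromℚᵘ x) (Q.fromℚᵘ y) ⟨
  Q.toℚᵘ (Q.fromℚᵘ x Q.* Q.fromℚᵘ y)                   ∎)
  where open ℚᵘ.≃-Reasoning

fromℚᵘ-homo-+ : ∀ x y → Q.fromℚᵘ (x ℚᵘ.+ y) ≡ Q.fromℚᵘ x Q.+ Q.fromℚᵘ y
fromℚᵘ-homo-+ x y = Q.toℚᵘ-injective (begin
  Q.toℚᵘ (Q.fromℚᵘ (x ℚᵘ.+ y))                         ≈⟨ Q.toℚᵘ-fromℚᵘ (x ℚᵘ.+ y) ⟩
  x ℚᵘ.+ y                                             ≈⟨ ℚᵘ.+-cong (Q.toℚᵘ-fromℚᵘ x) (Q.toℚᵘ-fromℚᵘ y) ⟨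
  Q.toℚᵘ (Q.fromℚᵘ x) ℚᵘ.+ Q.toℚᵘ (Q.fromℚᵘ y)         ≈⟨ Q.toℚᵘ-homo-+ (Q.fromℚᵘ x) (Q.fromℚᵘ y) ⟨
  Q.toℚᵘ (Q.fromℚᵘ x Q.+ Q.fromℚᵘ y)                   ∎)
  where open ℚᵘ.≃-Reasoning

fromℚᵘ-mono-≤ : ∀ {x y} → x ℚᵘ.≤ y → Q.fromℚᵘ x Q.≤ Q.fromℚᵘ y
fromℚᵘ-mono-≤ {x} {y} x≤y = Q.toℚᵘ-cancel-≤
  (ℚᵘ.≤-respʳ-≃ (ℚᵘ.≃-sym (Q.toℚᵘ-fromℚᵘ y)) (ℚᵘ.≤-respˡ-≃ (ℚᵘ.≃-sym (Q.toℚᵘ-fromℚᵘ x)) x≤y))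

fromℚᵘ-mono-< : ∀ {x y} → x ℚᵘ.< y → Q.fromℚᵘ x Q.< Q.fromℚᵘ y
fromℚᵘ-mono-< {x} {y} x<y = Q.toℚᵘ-cancel-<
  (ℚᵘ.<-respʳ-≃ (ℚᵘ.≃-sym (Q.toℚᵘ-fromℚᵘ y)) (ℚᵘ.<-respˡ-≃ (ℚᵘ.≃-sym (Q.toℚᵘ-fromℚᵘ x)) x<y))

ℕtoℚ-* : ∀ m n → ℕtoℚ (m * n) ≡ ℕtoℚ m Q.* ℕtoℚ n
ℕtoℚ-* m n = trans (cong (Q._/ 1) (ℤ.pos-* m n)) (fromℚᵘ-homo-* (ℚᵘ.mkℚᵘ (ℤ.+ m) 0) (ℚᵘ.mkℚᵘ (ℤ.+ n) 0))

ℕtoℚ-+ : ∀ m n → ℕtoℚ (m + n) ≡ ℕtoℚ m Q.+ ℕtoℚ n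
ℕtoℚ-+ m n = trans (cong (Q._/ 1) (cong₂ ℤ._+_ (sym (ℤ.*-identityʳ (ℤ.+ m))) (sym (ℤ.*-identityʳ (ℤ.+ n)))))
  (fromℚᵘ-homo-+ (ℚᵘ.mkℚᵘ (ℤ.+ m) 0) (ℚᵘ.mkℚᵘ (ℤ.+ n) 0))

ℕtoℚ-mono-≤ : ∀ {m n} → m ≤ n → ℕtoℚ m Q.≤ ℕtoℚ n
ℕtoℚ-mono-≤ {m} {n} m≤n = fromℚᵘ-mono-≤ {ℚᵘ.mkℚᵘ (ℤ.+ m) 0} {ℚᵘ.mkℚᵘ (ℤ.+ n) 0} (ℚᵘ.*≤* (ℤ.*-monoʳ-≤-nonNeg (ℤ.+ 1) (ℤ.+≤+ m≤n)))

ℕtoℚ-mono-< : ∀ {m n} → m < n → ℕtoℚ m Q.< ℕtoℚ n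
ℕtoℚ-mono-< {m} {n} m<n = fromℚᵘ-mono-< {ℚᵘ.mkℚᵘ (ℤ.+ m) 0} {ℚᵘ.mkℚᵘ (ℤ.+ n) 0} (ℚᵘ.*<* (ℤ.*-monoʳ-<-pos (ℤ.+ 1) (ℤ.+<+ m<n)))

ℕtoℚ-positive : ∀ {n} → 0 < n → Q.Positive (ℕtoℚ n)
ℕtoℚ-positive 0<n = Q.positive (ℕtoℚ-mono-< 0<n)

/-*-cancel : ∀ A B .{{_ : NonZero B}} → (ℤ.+ A) Q./ B Q.* ℕtoℚ B ≡ ℕtoℚ A
/-*-cancel A B@(suc B′) = trans (sym (fromℚᵘ-homo-* (ℚᵘ.mkℚᵘ (ℤ.+ A) B′) (ℚᵘ.mkℚᵘ (ℤ.+ B) 0)))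
  (Q.fromℚᵘ-cong {ℚᵘ.mkℚᵘ (ℤ.+ A) B′ ℚᵘ.* ℚᵘ.mkℚᵘ (ℤ.+ B) 0} {ℚᵘ.mkℚᵘ (ℤ.+ A) 0}
    (ℚᵘ.*≡* (trans (ℤ.*-identityʳ (ℤ.+ A ℤ.* ℤ.+ B)) (cong (λ b → ℤ.+ A ℤ.* ℤ.+ b) (sym (*-identityʳ B))))))

module _ {c : Q.ℚ} {A B : ℕ} (c*B≡A : c Q.* ℕtoℚ B ≡ ℕtoℚ A) where

  -- The rate enters only through c B = A, so the reduced form of A / B is never unfolded.
  ^ℚ-*-cancel : ∀ n → (c ^ℚ n) Q.* ℕtoℚ (B ^ n) ≡ ℕtoℚ (A ^ n)
  ^ℚ-*-cancel zero    = refl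
  ^ℚ-*-cancel (suc n) = begin
    c Q.* (c ^ℚ n) Q.* ℕtoℚ (B * B ^ n)             ≡⟨ cong (c Q.* (c ^ℚ n) Q.*_) (ℕtoℚ-* B (B ^ n)) ⟩
    c Q.* (c ^ℚ n) Q.* (ℕtoℚ B Q.* ℕtoℚ (B ^ n))    ≡⟨ interchange c (c ^ℚ n) (ℕtoℚ B) (ℕtoℚ (B ^ n)) ⟩
    c Q.* ℕtoℚ B Q.* ((c ^ℚ n) Q.* ℕtoℚ (B ^ n))    ≡⟨ cong₂ Q._*_ c*B≡A (^ℚ-*-cancel n) ⟩
    ℕtoℚ A Q.* ℕtoℚ (A ^ n)                         ≡⟨ ℕtoℚ-* A (A ^ n) ⟨
    ℕtoℚ (A * A ^ n)                                ∎
    where open ≡-Reasoning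

  ≤-^ℚ : 0 < B → ∀ {e n k} → e * B ^ n ≤ A ^ n * k → ℕtoℚ e Q.≤ (c ^ℚ n) Q.* ℕtoℚ k
  ≤-^ℚ B>0 {e} {n} {k} e≤ = Q.*-cancelʳ-≤-pos (ℕtoℚ (B ^ n)) {{ℕtoℚ-positive (m^n>0 B {{>-nonZero B>0}} n)}} (begin
    ℕtoℚ e Q.* ℕtoℚ (B ^ n)                      ≡⟨ ℕtoℚ-* e (B ^ n) ⟨
    ℕtoℚ (e * B ^ n)                             ≤⟨ ℕtoℚ-mono-≤ {e * B ^ n} {A ^ n * k} e≤ ⟩
    ℕtoℚ (A ^ n * k)                             ≡⟨ ℕtoℚ-* (A ^ n) k ⟩
    ℕtoℚ (A ^ n) Q.* ℕtoℚ k                      ≡⟨ cong (Q._* ℕtoℚ k) (^ℚ-*-cancel n) ⟨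
    (c ^ℚ n) Q.* ℕtoℚ (B ^ n) Q.* ℕtoℚ k         ≡⟨ xy∙z≈xz∙y (c ^ℚ n) (ℕtoℚ (B ^ n)) (ℕtoℚ k) ⟩
    (c ^ℚ n) Q.* ℕtoℚ k Q.* ℕtoℚ (B ^ n)         ∎)
    where open Q.≤-Reasoning

≤-rate : ∀ {c A B} → c Q.* ℕtoℚ B ≡ ℕtoℚ A → 0 < B → ∀ {s} X e n k →
  s ≤ suc (X + e) → e * B ^ n ≤ A ^ n * k → ℕtoℚ s Q.≤ ℕtoℚ X Q.+ (c ^ℚ n) Q.* ℕtoℚ k Q.+ Q.1ℚ
≤-rate {c} {A} {B} c*B≡A B>0 {s} X e n k s≤ e≤ = begin
  ℕtoℚ s                                          ≤⟨ ℕtoℚ-mono-≤ {s} {suc (X + e)} s≤ ⟩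
  ℕtoℚ (suc (X + e))                              ≡⟨ cong ℕtoℚ (+-comm 1 (X + e)) ⟩
  ℕtoℚ (X + e + 1)                                ≡⟨ trans (ℕtoℚ-+ (X + e) 1) (cong (Q._+ Q.1ℚ) (ℕtoℚ-+ X e)) ⟩
  ℕtoℚ X Q.+ ℕtoℚ e Q.+ Q.1ℚ                      ≤⟨ Q.+-monoˡ-≤ Q.1ℚ (Q.+-monoʳ-≤ (ℕtoℚ X) (≤-^ℚ {c} {A} {B} c*B≡A B>0 {e} {n} {k} e≤)) ⟩
  ℕtoℚ X Q.+ (c ^ℚ n) Q.* ℕtoℚ k Q.+ Q.1ℚ         ∎
  where open Q.≤-Reasoning

1<rate : ∀ {c A B} → c Q.* ℕtoℚ B ≡ ℕtoℚ A → 0 < B → B < A → Q.1ℚ Q.< c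
1<rate {c} {A} {B} c*B≡A B>0 B<A = Q.*-cancelʳ-<-nonNeg (ℕtoℚ B) {{Q.pos⇒nonNeg (ℕtoℚ B) {{ℕtoℚ-positive B>0}}}} (begin-strict
  Q.1ℚ Q.* ℕtoℚ B   ≡⟨ Q.*-identityˡ (ℕtoℚ B) ⟩
  ℕtoℚ B            <⟨ ℕtoℚ-mono-< {B} {A} B<A ⟩
  ℕtoℚ A            ≡⟨ c*B≡A ⟨
  c Q.* ℕtoℚ B      ∎)
  where open Q.≤-Reasoning

rate<k : ∀ {c A B} k → c Q.* ℕtoℚ B ≡ ℕtoℚ A → 0 < B → A < k * B → c Q.< ℕtoℚ k
rate<k {c} {A} {B} k c*B≡A B>0 A<kB = Q.*-cancelʳ-<-nonNeg (ℕtoℚ B) {{Q.pos⇒nonNeg (ℕtoℚ B) {{ℕtoℚ-positive B>0}}}} (begin-strict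
  c Q.* ℕtoℚ B        ≡⟨ c*B≡A ⟩
  ℕtoℚ A              <⟨ ℕtoℚ-mono-< {A} {k * B} A<kB ⟩
  ℕtoℚ (k * B)        ≡⟨ ℕtoℚ-* k B ⟩
  ℕtoℚ k Q.* ℕtoℚ B   ∎)
  where open Q.≤-Reasoning

-- The power of 2 is the outer factor: its share 2ⁿ (m - 1) is multiplied by k, while the share of k
-- stays unmultiplied, as in the theorem.
egz-constant-2^* : ∀ {k A B} → 1 < k → Bounded k A B → ∀ a n → 1 ≤ n →
  ∃ λ s → IsEGZConstant (2 ^ a * k) n s × ∃ λ e → s ≤ suc (2 ^ n * (2 ^ a ∸ 1) * k + e) × e * B ^ n ≤ A ^ n * (k ∸ 1)
egz-constant-2^* {k} 1<k bounded a n 1≤n =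
  let e , egz , e≤ = bounded n 1≤n
      s , const , s≤ = egz-constant (2 ^ a * k) n _
        (egz-* {{m^n≢0 2 a}} {{>-nonZero (<-trans (s≤s z≤n) 1<k)}} (egz-2^ a n) egz)
  in s , const , e , s≤ , e≤

theorem1p13 : (P : List ℕ) → P ≢ [] → All (λ p → Prime p × 3 ≤ p) P →
    (k : ℕ) → 1 < k → ((p : ℕ) → Prime p → p ∣ k → p ∈ P) →
    ((p : ℕ) → p ∈ P → (n : ℕ) → 1 ≤ n → PropertyD p n) →
    Σ Q.ℚ λ c → (Q.1ℚ Q.< c) × (c Q.< ℕtoℚ k) ×
    ((m : ℕ) → IsPowerOf2 m → (n : ℕ) → 1 ≤ n →
    ∃ λ s → IsEGZConstant (m * k) n s ×
    (ℕtoℚ s Q.≤ ℕtoℚ (2 ^ n * (m ∸ 1) * k) Q.+ (c ^ℚ n) Q.* ℕtoℚ (k ∸ 1) Q.+ Q.1ℚ))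
theorem1p13 P _ oddPrimes k 1<k factors⊆P propertyD =
  fromRated (rated-factors k 1<k λ p pr p∣k →
    let p∈P = factors⊆P p pr p∣k in rated-prime p pr (proj₂ (All.lookup oddPrimes p∈P)) (propertyD p p∈P))
  where
  fromRated : Rated k → Σ Q.ℚ λ c → (Q.1ℚ Q.< c) × (c Q.< ℕtoℚ k) ×
    ((m : ℕ) → IsPowerOf2 m → (n : ℕ) → 1 ≤ n → ∃ λ s → IsEGZConstant (m * k) n s ×
    (ℕtoℚ s Q.≤ ℕtoℚ (2 ^ n * (m ∸ 1) * k) Q.+ (c ^ℚ n) Q.* ℕtoℚ (k ∸ 1) Q.+ Q.1ℚ))
  fromRated (A , B , B>0 , B<A , A<kB , bounded) = c , 1<rate {c} {A} {B} c*B≡A B>0 B<A , rate<k {c} {A} {B} k c*B≡A B>0 A<kB ,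
    λ { m (a , refl) n 1≤n → let s , const , e , s≤ , e≤ = egz-constant-2^* 1<k bounded a n 1≤n in
        s , const , ≤-rate {c} {A} {B} c*B≡A B>0 (2 ^ n * (2 ^ a ∸ 1) * k) e n (k ∸ 1) s≤ e≤ }
    where
    instance
      B≢0 : NonZero B
      B≢0 = >-nonZero B>0
    c : Q.ℚ
    c = (ℤ.+ A) Q./ B
    c*B≡A : c Q.* ℕtoℚ B ≡ ℕtoℚ A
    c*B≡A = /-*-cancel A B
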